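{- Let $\mathcal{G}=(V,\mathit{Act},\mathcal{R})$ be a normed BPA system with $V$ linearly ordered, and let $\mathcal{T}^{\mathcal{G}}$ be its canonical transducer (defined in the context). Then: (1) $\mathcal{T}^{\mathcal{G}}$ is a (well-defined) nfc-transducer that is consistent with $\mathcal{G}$; (2) for all $\alpha,\beta\in V^*$: $\mathcal{T}^{\mathcal{G}}(\alpha)=\mathcal{T}^{\mathcal{G}}(\beta)$ if and only if $\alpha\sim\beta$ in $\mathcal{L}_{\mathcal{G}}$; (3) the size of $\mathcal{T}^{\mathcal{G}}$ is bounded by an exponential function of the size of $\mathcal{G}$.
   Context: A labelled transition system (LTS) is $\mathcal{L}=(S,\mathit{Act},(\xrightarrow{a})_{a\in \mathit{Act}})$; $\tau\in\mathit{Act}$ denotes the silent action. A relation $\mathcal{B}\subseteq S\times S$ is a branching bisimulation if for every $(s,t)\in\mathcal{B}$: (i) for every $s\xrightarrow{a}s'$, either $a=\tau$ and $(s',t)\in\mathcal{B}$, or there is a path $t=t_0\xrightarrow{\tau}t_1\xrightarrow{\tau}\cdots\xrightarrow{\tau}t_k\xrightarrow{a}t'$ ($k\ge 0$) with $(s',t')\in\mathcal{B}$ and $(s,t_i)\in\mathcal{B}$ for all $i\in[1,k]$; (ii) symmetrically for every move $t\xrightarrow{a}t'$ matched from $s$. Branching bisimilarity $\sim$ is the union of all branching bisimulations. A BPA system is $\mathcal{G}=(V,\mathit{Act},\mathcal{R})$ with finite set $V$ of variables, finite set $\mathit{Act}$ of actions (possibly containing $\tau$), finite set $\mathcal{R}$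 of rules $A\xrightarrow{a}\alpha$ ($A\in V$, $a\in\mathit{Act}$, $\alpha\in V^*$). Its LTS $\mathcal{L}_{\mathcal{G}}$ has states $V^*$ and transitions $A\beta\xrightarrow{a}\alpha\beta$ for each rule $A\xrightarrow{a}\alpha$ and $\beta\in V^*$. $\mathcal{G}$ is normed if for every $A\in V$ there is $w\in\mathit{Act}^*$ with $A\xrightarrow{w}\varepsilon$ in $\mathcal{L}_{\mathcal{G}}$. A transducer is $\mathcal{T}=(Q,V,\Delta,q_0)$ with finite state set $Q$, $\Delta:Q\times V\to Q\times V^*$, initial state $q_0$, reading/writing right to left. Write $q'\xleftarrow{A/\gamma}q$ for $\Delta(q,A)=(q',\gamma)$, extended by $q\xleftarrow{\varepsilon/\varepsilon}q$ and: if $q'\xleftarrow{A/\gamma}q$ and $q''\xleftarrow{\alpha/\beta}q'$ then $q''\xleftarrow{\alpha A/\beta\gamma}q$. $\mathcal{T}_q(\alpha)$ is the $\beta$ with $q'\xleftarrow{\alpha/\beta}q$; $\mathcal{T}(\alpha)=\mathcal{T}_{q_0}(\alpha)$. A $q$-normal form is $\varepsilon$ or $A_k\cdots A_1$ with $q_k\xleftarrow{A_k/A_k}q_{k-1}\cdots q_1\xleftarrow{A_1/A_1}q$. $\mathcal{T}$ is an nfc-transducer if for all $q,A$: $\mathcal{T}_q(A)$ is a $q$-normal form and $q'\xleftarrow{A/\gamma}q$ implies $q'\xleftarrow{\gamma/\gamma}q$. The size of a transducer is measured by its number of states, alphabet, and the total length of its output strings. For fixed $\mathcal{G},\mathcal{T}$: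 $\alpha\overset{a}{\Rightarrow}_q\beta$ holds if either $a=\tau$ and $\beta=\mathcal{T}_q(\alpha)$, or $\alpha=\alpha_0\xrightarrow{\tau}\alpha_1\cdots\xrightarrow{\tau}\alpha_k\xrightarrow{a}\beta'$ in $\mathcal{L}_{\mathcal{G}}$ ($k\ge0$) with $\mathcal{T}_q(\alpha_0)=\cdots=\mathcal{T}_q(\alpha_k)$ and $\mathcal{T}_q(\beta')=\beta$. $\alpha_1\approx_q\alpha_2$ iff for all $a\in\mathit{Act}$ the sets $\{\beta\mid\alpha_i\overset{a}{\Rightarrow}_q\beta\}$ ($i=1,2$) coincide. An nfc-transducer $\mathcal{T}$ is consistent with $\mathcal{G}$ if: (1) $A\approx_{q_0}\varepsilon$ whenever $\mathcal{T}_{q_0}(A)=\varepsilon$; (2) $A\approx_q\mathcal{T}_q(A)$ whenever $\mathcal{T}_q(A)\ne\varepsilon$; (3) $AC\approx_q C$ whenever $\mathcal{T}_q(AC)=\mathcal{T}_q(C)=C$. Canonical transducer. For $\gamma\in V^*$ let $R_\gamma=\{X\in V\mid X\gamma\sim\gamma\}$ (w.r.t. $\sim$ in $\mathcal{L}_{\mathcal{G}}$). The prefix $\alpha$ of $\alpha\gamma$ is redundancy-free if it cannot be written as $\alpha=\delta X\beta$ with $X\beta\gamma\sim\beta\gamma$. Given a linear order on $V$, $\alpha$ is lexicographically smaller than $\beta$ if $\alpha$ is a proper suffix of $\beta$, or $\alpha=\alpha'A\gamma$, $\beta=\beta'B\gamma$ with $A$ less than $B$. The canonical transducer $\mathcal{T}^{\mathcal{G}}=(Q,V,\Delta,q_0)$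 has $Q=\{R_\gamma\mid\gamma\in V^*\}$, $q_0=R_\varepsilon$, and for each $R_\gamma\in Q$, $A\in V$: $\Delta(R_\gamma,A)=(R_{A\gamma},\alpha)$ where $\alpha$ is the lexicographically smallest among the longest strings $\alpha$ satisfying (a) $\alpha\gamma\sim A\gamma$ and (b) $\alpha$ is a redundancy-free prefix of $\alpha\gamma$. -}

module Defs where

open import Level using (0ℓ)
open import Data.Nat using (ℕ; _+_; _*_; _^_; _≤_)
open import Data.Fin using (Fin)
open import Data.List using (List; []; _∷_; _++_; length; map; allFin; [_])
open import Data.Nat.ListAction using (sum)
open import Data.List.Membership.Propositional using (_∈_)
open import Data.Maybe using (Maybe; just; nothing)
open import Data.Product using (Σ; ∃; ∃-syntax; _×_; _,_; proj₁; proj₂)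
open import Data.Sum using (_⊎_)
open import Data.Unit using (⊤)
open import Relation.Nullary using (¬_)
open import Relation.Binary.PropositionalEquality using (_≡_; _≢_)
open import Relation.Binary using (Rel)

-- BPA systems.  Variables V = Fin n, actions Act = Fin m.
-- `tau` designates the silent action τ if τ ∈ Act (nothing if τ ∉ Act).
-- A rule A --a--> α is a triple (A , a , α).

record BPA (n m : ℕ) : Set where
  field
    tau   : Maybe (Fin m)
    rules : List (Fin n × Fin m × List (Fin n))

sizeBPA : ∀ {n m} → BPA n m → ℕ
sizeBPA {n} {m} G = n + m + sum (map (λ r → 2 + length (proj₂ (proj₂ r))) (BPA.rules G))

record Transducer (n : ℕ) : Set where
  field
    Q  : ℕ
    Δ  : Fin Q → Fin n → Fin Q × List (Fin n)
    q0 : Fin Q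

module _ {n : ℕ} (T : Transducer n) where
  open Transducer T

  -- run q α = (q' , β)  iff  q' <--α/β-- q   (reading right to left)
  run : Fin Q → List (Fin n) → Fin Q × List (Fin n)
  run q [] = q , []
  run q (x ∷ xs) with run q xs
  ... | q₁ , out₁ with Δ q₁ x
  ... | q₂ , o = q₂ , (o ++ out₁)

  out : Fin Q → List (Fin n) → List (Fin n)
  out q α = proj₂ (run q α)

  apply : List (Fin n) → List (Fin n)
  apply α = out q0 α

  NormalForm : Fin Q → List (Fin n) → Set
  NormalForm q [] = ⊤
  NormalForm q (x ∷ xs) = NormalForm q xs × proj₂ (Δ (proj₁ (run q xs)) x) ≡ [ x ]

  IsNFC : Set
  IsNFC = ∀ q A → NormalForm q (out q [ A ])
                  × run q (proj₂ (Δ q A)) ≡ Δ q A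

  sizeT : ℕ
  sizeT = Q + n + sum (map (λ q → sum (map (λ A → length (proj₂ (Δ q A))) (allFin n))) (allFin Q))

module _ {n m : ℕ} (G : BPA n m) where
  open BPA G

  Word : Set
  Word = List (Fin n)

  data Step : Word → Fin m → Word → Set where
    step : ∀ {A a α β} → (A , a , α) ∈ rules → Step (A ∷ β) a (α ++ β)

  IsTau : Fin m → Set
  IsTau a = tau ≡ just a

  TauStep : Word → Word → Set
  TauStep s t = Σ (Fin m) λ a → IsTau a × Step s a t

  data TauRun (P : Word → Set) : Word → Word → Set where
    done : ∀ {t} → TauRun P t t
    more : ∀ {t t₁ u} → TauStep t t₁ → P t₁ → TauRun P t₁ u → TauRun P t u

  data Steps : Word → Word → Set where
    done : ∀ {s} → Steps s s
    more : ∀ {s a s' u} → Step s a s' → Steps s' u → Steps s u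

  Normed : Set
  Normed = ∀ (A : Fin n) → Steps [ A ] []

  Matches : (Word → Word → Set) → Word → Word → Set
  Matches B s t = ∀ a s' → Step s a s' →
      (IsTau a × B s' t)
    ⊎ (Σ Word λ tk → Σ Word λ t' → TauRun (B s) t tk × Step tk a t' × B s' t')

  IsBranchingBisim : (Word → Word → Set) → Set
  IsBranchingBisim B = ∀ s t → B s t → Matches B s t × Matches (λ x y → B y x) t s

  _∼_ : Word → Word → Set₁
  s ∼ t = Σ (Word → Word → Set) λ B → IsBranchingBisim B × B s t

  module _ (T : Transducer n) where
    open Transducer T

    WeakStep : Fin Q → Word → Fin m → Word → Set
    WeakStep q α a β =
        (IsTau a × β ≡ out T q α)
      ⊎ (Σ Word λ αk → Σ Word λ β' →
           TauRun (λ α' → out T q α' ≡ out T q α) α αk × Step αk a β' × out T q β' ≡ β)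

    Approx : Fin Q → Word → Word → Set
    Approx q α₁ α₂ = ∀ a β → (WeakStep q α₁ a β → WeakStep q α₂ a β)
                           × (WeakStep q α₂ a β → WeakStep q α₁ a β)

    Consistent : Set
    Consistent =
        (∀ A → out T q0 [ A ] ≡ [] → Approx q0 [ A ] [])
      × (∀ q A → out T q [ A ] ≢ [] → Approx q [ A ] (out T q [ A ]))
      × (∀ q A C → out T q (A ∷ C ∷ []) ≡ [ C ] → out T q [ C ] ≡ [ C ]
                 → Approx q (A ∷ C ∷ []) [ C ])

  R : Word → Fin n → Set₁
  R γ X = (X ∷ γ) ∼ γ

  SameR : Word → Word → Set₁
  SameR γ γ' = ∀ X → (R γ X → R γ' X) × (R γ' X → R γ X)

  RedundancyFree : Word → Word → Set₁
  RedundancyFree α γ =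
    ¬ (Σ Word λ δ → Σ (Fin n) λ X → Σ Word λ β →
         (α ≡ δ ++ (X ∷ β)) × ((X ∷ (β ++ γ)) ∼ (β ++ γ)))

  module _ (_<V_ : Rel (Fin n) 0ℓ) where

    LexLt : Word → Word → Set
    LexLt α β =
        (Σ Word λ δ → δ ≢ [] × β ≡ δ ++ α)
      ⊎ (Σ Word λ α' → Σ Word λ β' → Σ (Fin n) λ A → Σ (Fin n) λ B → Σ Word λ γ →
           α ≡ α' ++ (A ∷ γ) × β ≡ β' ++ (B ∷ γ) × A <V B)

    Cand : Fin n → Word → Word → Set₁
    Cand A γ α = ((α ++ γ) ∼ (A ∷ γ)) × RedundancyFree α γ

    CanonOut : Fin n → Word → Word → Set₁
    CanonOut A γ α =
        Cand A γ α
      × (∀ α' → Cand A γ α' → length α' ≤ length α)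
      × (∀ α' → Cand A γ α' → length α' ≡ length α → α ≡ α' ⊎ LexLt α α')

    -- T is (up to renaming of its states) the canonical transducer T^G:
    -- `st γ` is the state R_γ; states are exactly the sets R_γ (st is onto,
    -- and st γ = st γ' iff R_γ = R_γ'); q0 = R_ε; Δ(R_γ, A) = (R_{Aγ}, α)
    -- with α the canonical output.
    IsCanonical : Transducer n → Set₁
    IsCanonical T =
      Σ (Word → Fin Q) λ st →
          st [] ≡ q0
        × (∀ q → Σ Word λ γ → st γ ≡ q)
        × (∀ γ γ' → (st γ ≡ st γ' → SameR γ γ') × (SameR γ γ' → st γ ≡ st γ'))
        × (∀ γ A → proj₁ (Δ (st γ) A) ≡ st (A ∷ γ)
                   × CanonOut A γ (proj₂ (Δ (st γ) A)))
      where open Transducer T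

{-# OPTIONS --safe #-}
-- The constructive difficulty is that building the canonical transducer requires deciding ∼.
--
-- Counting the steps that change the class makes words behave well: if α γ ∼ γ then α can be erased
-- silently inside one class, a redundancy-free α with α γ ∼ A γ is no longer than a run from A to ε, and
-- if α A γ ∼ β B γ then δ A γ ∼ B γ or δ B γ ∼ A γ for some δ. Moreover R γ determines which words are
-- bisimilar in front of γ. Hence canonical outputs depend only on R γ, they consist of letters that are
-- their own canonical outputs, and normal forms of bisimilar words coincide.
--
-- Conversely, for every consistent nfc-transducer, equality of outputs is a branching bisimulation.
-- Consistency is decidable, since weak steps are least fixpoints over finitely many pairs (state, letter),
-- and the canonical transducer exists up to double negation with outputs bounded by the norm. So α ∼ β is
-- decided by searching the finitely many consistent nfc-transducers within this bound, and once ∼ is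
-- decidable the canonical transducer can be constructed outright.
module Submission where

open import Defs
open import Level using (Level; 0ℓ; _⊔_)
open import Data.Nat using (ℕ; zero; suc; _+_; _*_; _^_; _≤_; _<_; z≤n; s≤s)
import Data.Nat.Properties as ℕ
open import Data.Nat.ListAction using (sum)
open import Data.Nat.Tactic.RingSolver using (solve-∀)
open import Data.Fin using (Fin; zero; suc; toℕ; combine; remQuot; finToFun; funToFin)
import Data.Fin.Properties as Fin
open import Data.List using (List; []; _∷_; _++_; length; map; allFin; [_]; reverse; drop; cartesianProductWith)
import Data.List.Properties as List
open import Data.List.Membership.Propositional using (_∈_; find; lose)
open import Data.List.Membership.Propositional.Properties using (∈-++⁺ˡ; ∈-++⁺ʳ; ∈-allFin; ∈-cartesianProductWith⁺)
open import Data.List.Relation.Unary.Any using (Any; here; there; any?)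
import Data.List.Relation.Unary.Any as Any
open import Data.List.Relation.Unary.All using (All; []; _∷_; all?)
import Data.List.Relation.Unary.All as All
import Data.List.Relation.Unary.All.Properties as All
open import Data.List.Relation.Binary.Lex.Core using (base; halt; this; next)
import Data.List.Relation.Binary.Lex.Strict as Lex
open import Data.List.Relation.Binary.Pointwise using (Pointwise-≡⇒≡; ≡⇒Pointwise-≡)
open import Data.Maybe using (just)
import Data.Maybe.Properties as Maybe
open import Data.Product using (Σ; _×_; _,_; proj₁; proj₂; uncurry)
open import Data.Product.Properties using () renaming (≡-dec to ,-≡-dec)
open import Data.Sum using (_⊎_; inj₁; inj₂)
open import Data.Empty using (⊥; ⊥-elim)
open import Data.Unit using (tt)
open import Data.Vec using (Vec; []; _∷_; lookup; tabulate)
import Data.Vec.Properties as Vec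
open import Function using (_∘_; id; case_of_)
open import Relation.Nullary using (¬_; Dec; yes; no; contradiction)
open import Relation.Nullary.Decidable using (map′; _×-dec_; _⊎-dec_; _→-dec_; ¬?; decidable-stable; True; toWitness; fromWitness)
open import Relation.Binary using (Rel; tri<; tri≈; tri>)
open import Relation.Binary.Structures using (IsStrictTotalOrder)
open import Relation.Binary.PropositionalEquality using (_≡_; _≢_; refl; sym; trans; cong; cong₂; subst; subst₂; module ≡-Reasoning)

-- `∼` quantifies over `Set`-valued relations and therefore lives in `Set₁`, so it cannot itself
-- serve as a bisimulation. Every proof of bisimilarity exhibits a `Set`-valued relation assembled
-- from the witnesses of the given bisimilarities, and arguments about all bisimilar pairs have to
-- be cut down to families indexed by a `Set`.
--
-- Minimal norms and membership in `R γ` cannot be decided at first, so the lemmas that need them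
-- conclude under double negation. Nothing is lost, since what is finally drawn from them is an
-- equality of words or a weak step of a fixed transducer, both decidable and hence stable. For the
-- same reason states are compared by `≎`, equality of the sets `R γ` up to double negation, and
-- `Canonical` is specified through `≎` and `CanonOut` alone. Its properties thus hold before
-- bisimilarity is decided. They apply to the transducer that merely cannot fail to exist as well as
-- to the one constructed afterwards, and no circularity arises.
--
-- Normedness acts in two ways: a word bisimilar to the empty word can erase itself silently, and
-- the weight of a run to the empty word is a measure for descent.

-- Decidable least fixpoints on finite sets

module LeastFixpoint
  (J : Set) (N : ℕ) (enc : J → Fin N) (dec : Fin N → J) (dec-enc : ∀ j → dec (enc j) ≡ j)
  (Φ : (J → Set) → J → Set)
  (Φ-mono : ∀ {P P′ : J → Set} → (∀ j → P j → P′ j) → ∀ j → Φ P j → Φ P′ j)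
  (Φ-dec : ∀ {P : J → Set} → (∀ j → Dec (P j)) → ∀ j → Dec (Φ P j))
  where

  approx : ℕ → J → Set
  approx zero    j = ⊥
  approx (suc k) j = Φ (approx k) j

  approx? : ∀ k j → Dec (approx k j)
  approx? zero    j = no id
  approx? (suc k) j = Φ-dec (approx? k) j

  approx-≤ : ∀ {k l} → k ≤ l → ∀ j → approx k j → approx l j
  approx-≤ {l = zero}  z≤n j = id
  approx-≤ {l = suc l} z≤n j ()
  approx-≤ (s≤s k≤l) j = Φ-mono (approx-≤ k≤l) j

  Closed : ℕ → Set
  Closed k = ∀ j → approx (suc k) j → approx k j

  New : ℕ → Set
  New k = Σ J λ j → approx (suc k) j × ¬ approx k j

  closed⊎new : ∀ k → Closed k ⊎ New k
  closed⊎new k with Fin.any? (λ i → approx? (suc k) (dec i) ×-dec ¬? (approx? k (dec i)))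
  ... | yes (i , new) = inj₂ (dec i , new)
  ... | no ¬new = inj₁ λ j p → subst (approx k) (dec-enc j)
          (decidable-stable (approx? k (dec (enc j)))
            λ ¬q → ¬new (enc j , subst (approx (suc k)) (sym (dec-enc j)) p , ¬q))

  closed-≤ : ∀ {k l} → k ≤ l → Closed k → Closed l
  closed-≤ {k} k≤l c with ℕ.m≤n⇒∃[o]m+o≡n k≤l
  ... | d , refl = go d
    where
    go : ∀ d → Closed (k + d)
    go zero    rewrite ℕ.+-identityʳ k = c
    go (suc d) rewrite ℕ.+-suc k d = λ j → Φ-mono (go d) j

  -- If none of the levels from 0 to `N` were closed, each would have a new element. An element new
  -- at `k` lies in `approx l` for all `l > k`, one new at `l` does not, so these `N + 1` elements
  -- would have distinct codes in `Fin N`.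
  closedAtSomeLevel : Σ ℕ λ k → k ≤ N × Closed k
  closedAtSomeLevel with Fin.any? {n = suc N} (λ k → closed? (toℕ k))
    where
    closed? : ∀ k → Dec (Closed k)
    closed? k with closed⊎new k
    ... | inj₁ c = yes c
    ... | inj₂ (j , p , ¬p) = no λ c → ¬p (c j p)
  ... | yes (k , c) = toℕ k , ℕ.≤-pred (Fin.toℕ<n k) , c
  ... | no ¬c = ⊥-elim (distinct (Fin.pigeonhole (ℕ.n<1+n N) (λ k → enc (proj₁ (new k)))))
    where
    new : ∀ (k : Fin (suc N)) → New (toℕ k)
    new k with closed⊎new (toℕ k)
    ... | inj₁ c = ⊥-elim (¬c (k , c))
    ... | inj₂ w = w
    distinct : ¬ (Σ (Fin (suc N)) λ k → Σ (Fin (suc N)) λ l →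
                   toℕ k < toℕ l × enc (proj₁ (new k)) ≡ enc (proj₁ (new l)))
    distinct (k , l , k<l , eq) = proj₂ (proj₂ (new l))
      (subst (approx (toℕ l))
        (trans (sym (dec-enc _)) (trans (cong dec eq) (dec-enc _)))
        (approx-≤ k<l _ (proj₁ (proj₂ (new k)))))

  lfp : J → Set
  lfp = approx N

  lfp? : ∀ j → Dec (lfp j)
  lfp? = approx? N

  lfp-closed : ∀ j → Φ lfp j → lfp j
  lfp-closed = let (_ , k≤N , c) = closedAtSomeLevel in closed-≤ k≤N c

  lfp-ind : ∀ {P : J → Set} → (∀ j → Φ P j → P j) → ∀ j → lfp j → P j
  lfp-ind {P} closed = go N
    where
    go : ∀ k j → approx k j → P j
    go (suc k) j p = closed j (Φ-mono (go k) j p)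

-- Double negation, continuations and list lemmas

¬¬-bind : ∀ {a b} {A : Set a} {B : Set b} → ¬ ¬ A → (A → ¬ ¬ B) → ¬ ¬ B
¬¬-bind ¬¬a f ¬b = ¬¬a λ a → f a ¬b

¬¬-dec : ∀ {a} (A : Set a) → ¬ ¬ Dec A
¬¬-dec A ¬d = ¬d (no λ a → ¬d (yes a))

Cont : ∀ {r a} → Set r → Set a → Set (r ⊔ a)
Cont Ans A = (A → Ans) → Ans

-- For `Ans` = `⊥` this is the double negation shift, constructively valid because the index set is
-- finite.
Cont-Fin : ∀ {r a} {Ans : Set r} {n} {P : Fin n → Set a} →
           (∀ i → Cont Ans (P i)) → Cont Ans (∀ i → P i)
Cont-Fin {n = zero}  f k = k λ ()
Cont-Fin {n = suc n} f k = f zero λ p → Cont-Fin (f ∘ suc) λ ps → k λ { zero → p ; (suc i) → ps i }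

Cont-All : ∀ {r a b} {Ans : Set r} {A : Set a} {P : A → Set b} →
           (∀ x → Cont Ans (P x)) → ∀ xs → Cont Ans (All P xs)
Cont-All f []       k = k []
Cont-All f (x ∷ xs) k = f x λ p → Cont-All f xs λ ps → k (p ∷ ps)

x++y≡y⇒x≡[] : ∀ {A : Set} (α : List A) {γ} → α ++ γ ≡ γ → α ≡ []
x++y≡y⇒x≡[] α {γ} eq = List.++-cancelʳ γ α [] eq

++-length-≤ : ∀ {A : Set} (α : List A) {β} → length β ≤ length (α ++ β)
++-length-≤ α {β} = subst (length β ≤_) (sym (List.length-++ α)) (ℕ.m≤n+m _ (length α))

drop-length-++ : ∀ {A : Set} (α : List A) {β} → drop (length α) (α ++ β) ≡ β
drop-length-++ []      = refl
drop-length-++ (x ∷ α) = drop-length-++ α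

-- Branching bisimilarity as a congruence

module Bisimilarity {n m : ℕ} (G : BPA n m) where

  infix 4 _≈_
  _≈_ : Word G → Word G → Set₁
  _≈_ = _∼_ G

  Simulation : (Word G → Word G → Set) → Set
  Simulation B = ∀ {s t} → B s t → Matches G B s t

  TauRun-map : ∀ {P P′ : Word G → Set} {s t} → (∀ {x} → P x → P′ x) → TauRun G P s t → TauRun G P′ s t
  TauRun-map f done         = done
  TauRun-map f (more s p r) = more s (f p) (TauRun-map f r)

  TauRun-++ : ∀ {P : Word G → Set} {s t u} → TauRun G P s t → TauRun G P t u → TauRun G P s u
  TauRun-++ done         r′ = r′
  TauRun-++ (more s p r) r′ = more s p (TauRun-++ r r′)

  -- `TauRun` constrains every word of the run except the first, so the empty run needs the
  -- hypothesis `P s`.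
  TauRun-end : ∀ {P : Word G → Set} {s t} → P s → TauRun G P s t → P t
  TauRun-end p done         = p
  TauRun-end _ (more _ p r) = TauRun-end p r

  TauRun-unsnoc : ∀ {P : Word G → Set} {s t} → TauRun G P s t →
                  s ≡ t ⊎ Σ (Word G) λ t⁻ → TauRun G P s t⁻ × TauStep G t⁻ t
  TauRun-unsnoc done = inj₁ refl
  TauRun-unsnoc (more s p r) with TauRun-unsnoc r
  ... | inj₁ refl           = inj₂ (_ , done , s)
  ... | inj₂ (t⁻ , r′ , s′) = inj₂ (t⁻ , more s p r′ , s′)

  Step-++ : ∀ {s a t} γ → Step G s a t → Step G (s ++ γ) a (t ++ γ)
  Step-++ γ (step {A} {a} {α} {β} r) =
    subst (Step G (A ∷ (β ++ γ)) a) (sym (List.++-assoc α β γ)) (step r)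

  TauRun-lift : ∀ {P P′ : Word G → Set} {s t} γ → (∀ {x} → P x → P′ (x ++ γ)) →
                TauRun G P s t → TauRun G P′ (s ++ γ) (t ++ γ)
  TauRun-lift γ f done = done
  TauRun-lift γ f (more (a , τ , s) p r) = more (a , τ , Step-++ γ s) (f p) (TauRun-lift γ f r)

  -- Only the leftmost letter acts, so a run either leaves `γ` untouched or reaches exactly `γ` and
  -- goes on inside it. The final step is included to classify a run that stops at `γ`: that step
  -- belongs to `γ`.
  run-split : ∀ {P : Word G → Set} α {γ s t a t′} → s ≡ α ++ γ → TauRun G P s t → Step G t a t′ →
      (Σ (Word G) λ αₖ → Σ (Word G) λ α′ →
         TauRun G (λ x → P (x ++ γ)) α αₖ × Step G αₖ a α′ × t′ ≡ α′ ++ γ)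
    ⊎ (TauRun G (λ x → P (x ++ γ)) α [] × TauRun G P γ t)
  run-split [] refl r st = inj₂ (done , r)
  run-split (X ∷ α) {γ} refl done (step {α = ρ} ru) =
    inj₁ (X ∷ α , ρ ++ α , done , step ru , sym (List.++-assoc ρ α γ))
  run-split {P} (X ∷ α) {γ} refl (more (a , τ , step {α = ρ} ru) p r) st
    with run-split (ρ ++ α) (sym (List.++-assoc ρ α γ)) r st
       | subst P (sym (List.++-assoc ρ α γ)) p
  ... | inj₁ (αₖ , α′ , r′ , st′ , eq) | p′ = inj₁ (αₖ , α′ , more (a , τ , step ru) p′ r′ , st′ , eq)
  ... | inj₂ (r′ , r″)                 | p′ = inj₂ (more (a , τ , step ru) p′ r′ , r″)

  []-no-step : ∀ {P : Word G → Set} {t a t′} → TauRun G P [] t → Step G t a t′ → ⊥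
  []-no-step (more (_ , _ , ()) _ _)

  Matches-map : ∀ {B B′ : Word G → Word G → Set} {s t} → (∀ {x y} → B x y → B′ x y) →
                Matches G B s t → Matches G B′ s t
  Matches-map f M a s′ st with M a s′ st
  ... | inj₁ (τ , b) = inj₁ (τ , f b)
  ... | inj₂ (tₖ , t′ , r , st′ , b) = inj₂ (tₖ , t′ , TauRun-map f r , st′ , f b)

  mk≈ : ∀ {B : Word G → Word G → Set} {s t} → (∀ {x y} → B x y → B y x) → Simulation B → B s t → s ≈ t
  mk≈ {B} symm sim b = B , (λ s t b → sim b , Matches-map symm (sim (symm b))) , b

  -- Adding the converse relation keeps a bisimulation a bisimulation, and for a symmetric relation
  -- one direction of the transfer property suffices.
  record SymBisim (s t : Word G) : Set₁ where
    field
      rel     : Word G → Word G → Set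
      rel-sym : ∀ {x y} → rel x y → rel y x
      rel-sim : Simulation rel
      related : rel s t

  un≈ : ∀ {s t} → s ≈ t → SymBisim s t
  un≈ (B , bis , b) = record
    { rel     = λ x y → B x y ⊎ B y x
    ; rel-sym = λ { (inj₁ b) → inj₂ b ; (inj₂ b) → inj₁ b }
    ; rel-sim = λ { (inj₁ b) → Matches-map inj₁ (proj₁ (bis _ _ b))
                  ; (inj₂ b) → Matches-map inj₂ (proj₂ (bis _ _ b)) }
    ; related = inj₁ b }

  re≈ : ∀ {s t} (b : SymBisim s t) → ∀ {x y} → SymBisim.rel b x y → x ≈ y
  re≈ b = mk≈ (SymBisim.rel-sym b) (SymBisim.rel-sim b)

  ≈-refl : ∀ {s} → s ≈ s
  ≈-refl = mk≈ {_≡_} sym (λ { refl a s′ st → inj₂ (_ , _ , done , st , refl) }) refl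

  ≈-reflexive : ∀ {s t} → s ≡ t → s ≈ t
  ≈-reflexive refl = ≈-refl

  ≈-sym : ∀ {s t} → s ≈ t → t ≈ s
  ≈-sym e = re≈ (un≈ e) (SymBisim.rel-sym (un≈ e) (SymBisim.related (un≈ e)))

  Compose : (B B′ : Word G → Word G → Set) → Word G → Word G → Set
  Compose B B′ s t = Σ (Word G) λ u → B s u × B′ u t

  -- Each step out of `u` is answered by idling or by a run through words related to `u`. The
  -- partner `y` of every visited word is recorded because a branching bisimulation constrains all
  -- intermediate words, and so does the composite relation.
  run-match : ∀ {P : Word G → Set} {B : Word G → Word G → Set} {u uₖ t} → Simulation B →
              P u → TauRun G P u uₖ → B u t →
              Σ (Word G) λ tₖ → TauRun G (λ x → Σ (Word G) λ y → P y × B y x) t tₖ × P uₖ × B uₖ tₖ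
  run-match sim p done b = _ , done , p , b
  run-match {P} {B} sim p (more (a , τ , st) p₁ r) b with sim b a _ st
  ... | inj₁ (_ , b₁) = run-match sim p₁ r b₁
  ... | inj₂ (tₖ , t′ , r₁ , st₁ , b₁) with run-match sim p₁ r b₁
  ...   | t″ , r₂ , pₖ , bₖ =
    t″ , TauRun-++ (TauRun-map (λ b′ → _ , p , b′) r₁) (more (a , τ , st₁) (_ , p₁ , b₁) r₂) , pₖ , bₖ

  Compose-match : ∀ {B B′ : Word G → Word G → Set} → Simulation B → Simulation B′ → Simulation (Compose B B′)
  Compose-match sim sim′ (u , b , b′) a s′ st with sim b a s′ st
  ... | inj₁ (τ , b₁) = inj₁ (τ , u , b₁ , b′)
  ... | inj₂ (uₖ , u′ , r , st₁ , b₁) with run-match sim′ b r b′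
  ...   | tₖ , r₂ , bₖ , bₖ′ with sim′ bₖ′ a u′ st₁
  ...     | inj₂ (t″ , t′ , r₃ , st₂ , b₂) =
    inj₂ (t″ , t′ , TauRun-++ r₂ (TauRun-map (λ c → _ , bₖ , c) r₃) , st₂ , u′ , b₁ , b₂)
  -- The answer idles at `tₖ`, but a match that has moved must end in an action. The last silent
  -- step of `r₂` takes this role; if `r₂` is empty, the composite answer idles too.
  ...     | inj₁ (τ , b₂) with TauRun-unsnoc r₂
  ...       | inj₁ refl = inj₁ (τ , u′ , b₁ , b₂)
  ...       | inj₂ (t⁻ , r₃ , (a′ , τ′ , st₂)) with trans (sym τ) τ′
  ...         | refl = inj₂ (t⁻ , tₖ , r₃ , st₂ , u′ , b₁ , b₂)

  ≈-trans : ∀ {s t u} → s ≈ t → t ≈ u → s ≈ u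
  ≈-trans e e′ = mk≈ {λ x y → Compose B.rel B′.rel x y ⊎ Compose B′.rel B.rel x y}
    (λ { (inj₁ (u , b , b′)) → inj₂ (u , B′.rel-sym b′ , B.rel-sym b)
       ; (inj₂ (u , b , b′)) → inj₁ (u , B.rel-sym b′ , B′.rel-sym b) })
    (λ { (inj₁ c) → Matches-map inj₁ (Compose-match B.rel-sim B′.rel-sim c)
       ; (inj₂ c) → Matches-map inj₂ (Compose-match B′.rel-sim B.rel-sim c) })
    (inj₁ (_ , B.related , B′.related))
    where
    module B  = SymBisim (un≈ e)
    module B′ = SymBisim (un≈ e′)

  -- All words related to s stay related along the matching run, so ≈ itself satisfies the transfer
  -- property, with the run recorded for the relation of one fixed witness.
  ≈-match : ∀ {s t a s′} → s ≈ t → Step G s a s′ →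
      (IsTau G a × s′ ≈ t)
    ⊎ (Σ (Word G → Set) λ P → (∀ {x} → P x → s ≈ x) × Σ (Word G) λ tₖ → Σ (Word G) λ t′ →
         TauRun G P t tₖ × Step G tₖ a t′ × s′ ≈ t′)
  ≈-match e st with SymBisim.rel-sim (un≈ e) (SymBisim.related (un≈ e)) _ _ st
  ... | inj₁ (τ , b) = inj₁ (τ , re≈ (un≈ e) b)
  ... | inj₂ (tₖ , t′ , r , st′ , b) = inj₂ (_ , re≈ (un≈ e) , tₖ , t′ , r , st′ , re≈ (un≈ e) b)

  ≈-++ˡ : ∀ {α β} δ → α ≈ β → δ ++ α ≈ δ ++ β
  ≈-++ˡ δ e = mk≈ {C} symC simC (δ , _ , _ , refl , refl , B.related)
    where
    module B = SymBisim (un≈ e)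
    C : Word G → Word G → Set
    C x y = Σ (Word G) λ δ → Σ (Word G) λ a → Σ (Word G) λ b → x ≡ δ ++ a × y ≡ δ ++ b × B.rel a b
    symC : ∀ {x y} → C x y → C y x
    symC (δ , a , b , ea , eb , r) = δ , b , a , eb , ea , B.rel-sym r
    simC : Simulation C
    simC ([] , a , b , refl , refl , r) = Matches-map (λ r → [] , _ , _ , refl , refl , r) (B.rel-sim r)
    simC (X ∷ δ , a , b , refl , refl , r) _ _ (step {α = ρ} ru) =
      inj₂ (_ , _ , done , step ru , ρ ++ δ , a , b , sym (List.++-assoc ρ δ a) , sym (List.++-assoc ρ δ b) , r)

  Steps-++ : ∀ {s t} γ → Steps G s t → Steps G (s ++ γ) (t ++ γ)
  Steps-++ γ done       = done
  Steps-++ γ (more s r) = more (Step-++ γ s) (Steps-++ γ r)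

  Steps-trans : ∀ {s t u} → Steps G s t → Steps G t u → Steps G s u
  Steps-trans done       r′ = r′
  Steps-trans (more s r) r′ = more s (Steps-trans r r′)

  -- This lets a new `Set`-valued bisimulation absorb a whole family of pairs already known to be
  -- bisimilar.
  union-≈ : ∀ {I : Set} {s t : I → Word G} → (∀ i → s i ≈ t i) →
            Σ (Word G → Word G → Set) λ B →
              (∀ {x y} → B x y → B y x) × Simulation B × (∀ i → B (s i) (t i))
  union-≈ {I} e = (λ x y → Σ I λ i → SymBisim.rel (un≈ (e i)) x y)
    , (λ (i , b) → i , SymBisim.rel-sym (un≈ (e i)) b)
    , (λ (i , b) → Matches-map (λ b → i , b) (SymBisim.rel-sim (un≈ (e i)) b))
    , (λ i → i , SymBisim.related (un≈ (e i)))

  module _ (normed : Normed G) where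

    normed-word : ∀ α → Steps G α []
    normed-word []      = done
    normed-word (X ∷ α) = Steps-trans (Steps-++ α (normed X)) (normed-word α)

    -- `[]` has no transitions, so every step of a norming run of `β` can only be answered by
    -- idling: it is silent and leads to a word still related to `[]`.
    run-to-[] : ∀ {B : Word G → Word G → Set} → (∀ {x y} → B x y → B y x) → Simulation B →
                ∀ {β} → B [] β → TauRun G (B []) β []
    run-to-[] {B} symm sim b = go b (normed-word _)
      where
      go : ∀ {β} → B [] β → Steps G β [] → TauRun G (B []) β []
      go b done = done
      go b (more {a = a} {s' = β′} st sts) with sim (symm b) a β′ st
      ... | inj₁ (τ , b′) = more (a , τ , st) (symm b′) (go (symm b′) sts)
      ... | inj₂ (_ , _ , r , st′ , _) = ⊥-elim ([]-no-step r st′)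

    -- The critical pair has an empty prefix on one side: before a step of `γ` can be copied, the
    -- other prefix must erase itself silently within its class. Normedness supplies this run.
    ≈-++ʳ : ∀ {α β} γ → α ≈ β → α ++ γ ≈ β ++ γ
    ≈-++ʳ γ e = mk≈ {C} symC simC (inj₂ (_ , _ , refl , refl , B.related))
      where
      module B = SymBisim (un≈ e)
      C : Word G → Word G → Set
      C x y = x ≡ y ⊎ Σ (Word G) λ a → Σ (Word G) λ b → x ≡ a ++ γ × y ≡ b ++ γ × B.rel a b
      symC : ∀ {x y} → C x y → C y x
      symC (inj₁ eq) = inj₁ (sym eq)
      symC (inj₂ (a , b , ea , eb , r)) = inj₂ (b , a , eb , ea , B.rel-sym r)
      simC : Simulation C
      simC (inj₁ refl) a s′ st = inj₂ (_ , _ , done , st , inj₁ refl)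
      simC (inj₂ ([] , b , refl , refl , r)) a s′ st =
        inj₂ (_ , _ , TauRun-lift γ (λ r → inj₂ (_ , _ , refl , refl , r)) (run-to-[] B.rel-sym B.rel-sim r)
             , st , inj₁ refl)
      simC (inj₂ (X ∷ α , b , refl , refl , r)) a _ (step {α = ρ} ru) with B.rel-sim r a _ (step ru)
      ... | inj₁ (τ , r′) = inj₁ (τ , inj₂ (_ , _ , sym (List.++-assoc ρ α γ) , refl , r′))
      ... | inj₂ (bₖ , b′ , run , st , r′) =
        inj₂ (_ , _ , TauRun-lift γ (λ r → inj₂ (X ∷ α , _ , refl , refl , r)) run , Step-++ γ st
             , inj₂ (_ , _ , sym (List.++-assoc ρ α γ) , refl , r′))

-- Branching norms, redundancy and exchange of suffixes

module Norms {n m : ℕ} (G : BPA n m) (normed : Normed G) where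
  open Bisimilarity G

  -- The least k with Path s k [] is the branching norm of s.
  data Path : Word G → ℕ → Word G → Set₁ where
    nil  : ∀ {s} → Path s 0 s
    keep : ∀ {s s′ k t} → TauStep G s s′ → s ≈ s′ → Path s′ k t → Path s k t
    decr : ∀ {s a s′ k t} → Step G s a s′ → Path s′ k t → Path s (suc k) t

  Path-trans : ∀ {s k t l u} → Path s k t → Path t l u → Path s (k + l) u
  Path-trans nil          q = q
  Path-trans (keep s e p) q = keep s e (Path-trans p q)
  Path-trans (decr s p)   q = decr s (Path-trans p q)

  Path-zero : ∀ {s t} → Path s 0 t → s ≈ t
  Path-zero nil          = ≈-refl
  Path-zero (keep _ e p) = ≈-trans e (Path-zero p)

  run-Path : ∀ {P : Word G → Set} {s t tₖ} → (∀ {x} → P x → s ≈ x) → s ≈ t →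
             TauRun G P t tₖ → Path t 0 tₖ
  run-Path f e done         = nil
  run-Path f e (more s p r) = keep s (≈-trans (≈-sym e) (f p)) (run-Path f (f p) r)

  Path-[] : ∀ {t} → [] ≈ t → Path t 0 []
  Path-[] e = run-Path (re≈ (un≈ e)) e
    (run-to-[] normed (SymBisim.rel-sym (un≈ e)) (SymBisim.rel-sim (un≈ e)) (SymBisim.related (un≈ e)))

  -- `keep` steps stay in the class and need no answer. A counted step is answered for free or by a
  -- free run and one counted step, so the weight does not grow.
  Path-transfer : ∀ {s t k s′} → s ≈ t → Path s k s′ →
                  Σ ℕ λ k′ → Σ (Word G) λ t′ → k′ ≤ k × Path t k′ t′ × s′ ≈ t′
  Path-transfer e nil = 0 , _ , z≤n , nil , e
  Path-transfer e (keep _ e′ p) = Path-transfer (≈-trans (≈-sym e′) e) p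
  Path-transfer e (decr st p) with ≈-match e st
  ... | inj₁ (_ , e′) =
    let (k′ , t′ , k′≤k , q , e″) = Path-transfer e′ p in k′ , t′ , ℕ.m≤n⇒m≤1+n k′≤k , q , e″
  ... | inj₂ (P , f , tₖ , t′ , r , st′ , e′) =
    let (k′ , t″ , k′≤k , q , e″) = Path-transfer e′ p
    in suc k′ , t″ , s≤s k′≤k , Path-trans (run-Path f e r) (decr st′ q) , e″

  Path-[]-transfer : ∀ {s t k} → s ≈ t → Path s k [] → Σ ℕ λ k′ → k′ ≤ k × Path t k′ []
  Path-[]-transfer e p with Path-transfer e p
  ... | k′ , t′ , k′≤k , q , e′ =
    k′ , k′≤k , subst (λ l → Path _ l []) (ℕ.+-identityʳ k′) (Path-trans q (Path-[] e′))

  Path-split : ∀ α {γ s k t} → s ≡ α ++ γ → Path s k t →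
      (Σ (Word G) λ α′ → t ≡ α′ ++ γ)
    ⊎ (Σ ℕ λ k₁ → Σ ℕ λ k₂ → k₁ + k₂ ≡ k × Path s k₁ γ × Path γ k₂ t)
  Path-split []      refl p   = inj₂ (0 , _ , refl , nil , p)
  Path-split (X ∷ α) refl nil = inj₁ (X ∷ α , refl)
  Path-split (X ∷ α) {γ} refl (keep (a , τ , step {α = ρ} ru) e p)
    with Path-split (ρ ++ α) (sym (List.++-assoc ρ α γ)) p
  ... | inj₁ w = inj₁ w
  ... | inj₂ (k₁ , k₂ , eq , p₁ , p₂) = inj₂ (k₁ , k₂ , eq , keep (a , τ , step ru) e p₁ , p₂)
  Path-split (X ∷ α) {γ} refl (decr (step {α = ρ} ru) p)
    with Path-split (ρ ++ α) (sym (List.++-assoc ρ α γ)) p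
  ... | inj₁ w = inj₁ w
  ... | inj₂ (k₁ , k₂ , eq , p₁ , p₂) = inj₂ (suc k₁ , k₂ , cong suc eq , decr (step ru) p₁ , p₂)

  Path-through : ∀ α {γ k t} → (∀ α′ → t ≡ α′ ++ γ → t ≡ γ) → Path (α ++ γ) k t →
                 Σ ℕ λ k₁ → Σ ℕ λ k₂ → k₁ + k₂ ≡ k × Path (α ++ γ) k₁ γ × Path γ k₂ t
  Path-through α {k = k} h p with Path-split α refl p
  ... | inj₂ w = w
  ... | inj₁ (α′ , eq) with h α′ eq
  ...   | refl = k , 0 , ℕ.+-identityʳ k , p , nil

  Path-[]-through : ∀ α {γ k} → Path (α ++ γ) k [] →
                    Σ ℕ λ k₁ → Σ ℕ λ k₂ → k₁ + k₂ ≡ k × Path (α ++ γ) k₁ γ × Path γ k₂ []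
  Path-[]-through α = Path-through α λ α′ eq → sym (List.++-conicalʳ α′ _ (sym eq))

  Path-suffix-through : ∀ α β {γ k} → Path (α ++ (β ++ γ)) k γ →
    Σ ℕ λ k₁ → Σ ℕ λ k₂ → k₁ + k₂ ≡ k × Path (α ++ (β ++ γ)) k₁ (β ++ γ) × Path (β ++ γ) k₂ γ
  Path-suffix-through α β {γ} = Path-through α λ α′ eq →
    cong (_++ γ) (sym (List.++-conicalʳ α′ β
      (x++y≡y⇒x≡[] (α′ ++ β) (trans (List.++-assoc α′ β γ) (sym eq)))))

  Steps-Path : ∀ {s t} → Steps G s t → Σ ℕ λ k → Path s k t
  Steps-Path done        = 0 , nil
  Steps-Path (more st r) = let (k , p) = Steps-Path r in suc k , decr st p

  norm : ∀ s → Σ ℕ λ k → Path s k []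
  norm s = Steps-Path (normed-word normed s)

  -- Infinite descent on the number of decreasing steps: a run of α ++ γ to [] passes through γ.
  descent : ∀ N {k α γ} → k < N → Path γ k [] → α ++ γ ≈ γ → Path (α ++ γ) 0 γ
  descent (suc N) {α = α} (s≤s k≤N) p e with Path-[]-transfer (≈-sym e) p
  ... | k′ , k′≤k , q with Path-[]-through α q
  ...   | zero   , k₂ , eq   , q₁ , q₂ = q₁
  ...   | suc k₁ , k₂ , refl , q₁ , q₂ =
    descent N (ℕ.≤-trans (s≤s (ℕ.m≤n+m k₂ k₁)) (ℕ.≤-trans k′≤k k≤N)) q₂ e

  silent-path : ∀ α {γ} → α ++ γ ≈ γ → Path (α ++ γ) 0 γ
  silent-path α {γ} = descent _ (ℕ.n<1+n _) (proj₂ (norm γ))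

  -- The path of weight 0 to `γ` passes through `β ++ γ`, and its second half has weight 0 as well.
  ≈-suffix : ∀ α β {γ} → α ++ (β ++ γ) ≈ γ → β ++ γ ≈ γ
  ≈-suffix α β {γ} e
    with Path-suffix-through α β
           (subst (λ w → Path w 0 γ) (List.++-assoc α β γ)
             (silent-path (α ++ β) (≈-trans (≈-reflexive (List.++-assoc α β γ)) e)))
  ... | zero , zero , _ , _ , p = Path-zero p

  data RF : Word G → Word G → Set₁ where
    []  : ∀ {γ} → RF [] γ
    _∷_ : ∀ {X α γ} → ¬ (X ∷ (α ++ γ) ≈ α ++ γ) → RF α γ → RF (X ∷ α) γ

  RF⇒RedundancyFree : ∀ {α γ} → RF α γ → RedundancyFree G α γ
  RF⇒RedundancyFree []        ([]    , X , β , () , e)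
  RF⇒RedundancyFree []        (_ ∷ _ , X , β , () , e)
  RF⇒RedundancyFree (¬e ∷ rf) ([]    , X , β , refl , e) = ¬e e
  RF⇒RedundancyFree (¬e ∷ rf) (_ ∷ δ , X , β , refl , e) = RF⇒RedundancyFree rf (δ , X , β , refl , e)

  RedundancyFree⇒RF : ∀ {α γ} → RedundancyFree G α γ → RF α γ
  RedundancyFree⇒RF {[]}    rf = []
  RedundancyFree⇒RF {X ∷ α} rf =
    (λ e → rf ([] , X , α , refl , e))
    ∷ RedundancyFree⇒RF λ (δ , Y , β , eq , e) → rf (X ∷ δ , Y , β , cong (X ∷_) eq , e)

  RF-++⁺ : ∀ {α β γ} → RF α (β ++ γ) → RF β γ → RF (α ++ β) γ
  RF-++⁺ [] rf′ = rf′
  RF-++⁺ {X ∷ α} {β} {γ} (¬e ∷ rf) rf′ =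
    (λ e → ¬e (subst (λ w → X ∷ w ≈ w) (List.++-assoc α β γ) e)) ∷ RF-++⁺ rf rf′

  RF-++⁻ : ∀ α {β γ} → RF (α ++ β) γ → RF α (β ++ γ) × RF β γ
  RF-++⁻ []      rf = [] , rf
  RF-++⁻ (X ∷ α) {β} {γ} (¬e ∷ rf) =
    (λ e → ¬e (subst (λ w → X ∷ w ≈ w) (sym (List.++-assoc α β γ)) e)) ∷ proj₁ (RF-++⁻ α rf)
    , proj₂ (RF-++⁻ α rf)

  RF-≈ : ∀ {α γ γ′} → γ ≈ γ′ → RF α γ → RF α γ′
  RF-≈ e [] = []
  RF-≈ {X ∷ α} e (¬e ∷ rf) =
    (λ e′ → ¬e (≈-trans (≈-++ˡ (X ∷ α) e) (≈-trans e′ (≈-sym (≈-++ˡ α e))))) ∷ RF-≈ e rf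

  -- A leading letter removed with weight 0 would be redundant, so each letter costs at least one
  -- counted step.
  RF-length : ∀ {α γ k} → RF α γ → Path (α ++ γ) k γ → length α ≤ k
  RF-length [] p = z≤n
  RF-length {X ∷ α} (¬e ∷ rf) p with Path-suffix-through [ X ] α p
  ... | zero   , k₂ , eq   , p₁ , p₂ = ⊥-elim (¬e (Path-zero p₁))
  ... | suc k₁ , k₂ , refl , p₁ , p₂ = s≤s (ℕ.≤-trans (RF-length rf p₂) (ℕ.m≤n+m k₂ k₁))

  RF-≈⇒[] : ∀ {α γ} → RF α γ → α ++ γ ≈ γ → α ≡ []
  RF-≈⇒[] {[]}    rf e = refl
  RF-≈⇒[] {X ∷ α} rf e = contradiction (RF-length rf (silent-path (X ∷ α) e)) λ ()

  -- By `≈-suffix`, `γ` absorbs every suffix of `α`, so each letter can be moved directly in front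
  -- of `γ`. Together with `letters-≈`, this shows that `R γ` determines which words `γ` absorbs.
  ≈-letters : ∀ α {γ} → α ++ γ ≈ γ → All (λ X → X ∷ γ ≈ γ) α
  ≈-letters []      e = []
  ≈-letters (X ∷ α) e =
    let e′ = ≈-suffix [ X ] α e in ≈-trans (≈-++ˡ [ X ] (≈-sym e′)) e ∷ ≈-letters α e′

  letters-≈ : ∀ {α γ} → All (λ X → X ∷ γ ≈ γ) α → α ++ γ ≈ γ
  letters-≈ []       = ≈-refl
  letters-≈ {X ∷ α} (e ∷ es) = ≈-trans (≈-++ˡ [ X ] (letters-≈ es)) e

  Path-++ : ∀ {s k t} γ → Path s k t → Path (s ++ γ) k (t ++ γ)
  Path-++ γ nil                     = nil
  Path-++ γ (keep (a , τ , st) e p) = keep (a , τ , Step-++ γ st) (≈-++ʳ normed γ e) (Path-++ γ p)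
  Path-++ γ (decr st p)             = decr (Step-++ γ st) (Path-++ γ p)

  -- Put `pA` before a path of `γ` of weight `k` and transfer the result to `α ++ γ`: its two parts
  -- satisfy `k₁ + k₂ ≤ l + k`. Either `k₁ ≤ l` and `RF-length` applies, or `k₂ < k` and the
  -- argument is repeated with a lighter path of `γ`.
  Cand-length : ∀ {A l} → Path [ A ] l [] → ∀ {α γ} → α ++ γ ≈ A ∷ γ → RF α γ → length α ≤ l
  Cand-length {A} {l} pA {α} {γ} e rf = go _ (ℕ.n<1+n _) (proj₂ (norm γ))
    where
    go : ∀ N {k} → k < N → Path γ k [] → length α ≤ l
    go (suc N) {k} (s≤s k≤N) p with Path-[]-transfer (≈-sym e) (Path-trans (Path-++ γ pA) p)
    ... | k′ , k′≤ , q with Path-[]-through α q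
    ...   | k₁ , k₂ , refl , q₁ , q₂ with ℕ.<-cmp k₁ l
    ...     | tri< k₁<l _ _ = ℕ.≤-trans (RF-length rf q₁) (ℕ.<⇒≤ k₁<l)
    ...     | tri≈ _ refl _ = RF-length rf q₁
    ...     | tri> _ _ l<k₁ =
      go N (ℕ.≤-trans (ℕ.+-cancelˡ-< l k₂ k (ℕ.<-≤-trans (ℕ.+-monoˡ-< k₂ l<k₁) k′≤)) k≤N) q₂

  -- Two representations of one class: following a run of minimal weight from the second word to
  -- its suffix, the first word cannot lose its own suffix, if that has the smaller norm.
  suffix-match : ∀ α c {t d M k a b} → α ++ c ≈ t → (∀ {k} → Path (α ++ c) k [] → M ≤ k) →
                 Path t k d → k + b ≤ M → Path c a [] → a ≤ b → Σ (Word G) λ δ → δ ++ c ≈ d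
  suffix-match α c {a = a} {b} e min p k+b≤M pc a≤b with Path-transfer (≈-sym e) p
  ... | k′ , ω , k′≤k , q , e′ with Path-split α refl q
  ...   | inj₁ (α′ , refl) = α′ , ≈-sym e′
  ...   | inj₂ (j₁ , zero , refl , q₁ , q₂) = [] , ≈-trans (Path-zero q₂) (≈-sym e′)
  -- Here `k + b ≤ M ≤ j₁ + a ≤ j₁ + b` gives `k ≤ j₁`, although `j₁ + suc j₂ ≤ k`.
  ...   | inj₂ (j₁ , suc j₂ , refl , q₁ , q₂) = contradiction
    (ℕ.≤-trans k+b≤M (ℕ.≤-trans (min (Path-trans q₁ pc)) (ℕ.+-monoʳ-≤ j₁ a≤b)))
    (ℕ.<⇒≱ (ℕ.+-monoˡ-< b (ℕ.<-≤-trans (ℕ.m<m+n j₁ (s≤s z≤n)) k′≤k)))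

  ¬¬-minimal : ∀ s → ¬ ¬ (Σ ℕ λ k → Path s k [] × (∀ {l} → Path s l [] → k ≤ l))
  ¬¬-minimal s ¬min = go (suc (proj₁ (norm s))) (ℕ.n<1+n _) (proj₂ (norm s))
    where
    go : ∀ N {k} → k < N → ¬ Path s k []
    go (suc N) {k} (s≤s k≤N) p = ¬min (k , p , λ q → ℕ.≮⇒≥ λ l<k → go N (ℕ.≤-trans l<k k≤N) q)

  -- A lightest path of one side and its transfer to the other are cut at the suffixes, leaving
  -- weights `a` and `b`. The suffix with the smaller remaining weight is still present when the
  -- other side arrives at its own suffix.
  suffixes-comparable : ∀ α β c d → α ++ c ≈ β ++ d →
    ¬ ¬ ((Σ (Word G) λ δ → δ ++ c ≈ d) ⊎ (Σ (Word G) λ δ → δ ++ d ≈ c))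
  suffixes-comparable α β c d e = ¬¬-bind (¬¬-minimal (α ++ c)) λ (M , p , min) ¬goal →
    let (k₁ , a , eq₁ , p₁ , pc) = Path-[]-through α p
        (M′ , M′≤M , q)          = Path-[]-transfer e p
        (k₂ , b , eq₂ , q₁ , qd) = Path-[]-through β q
        min′ : ∀ {k} → Path (β ++ d) k [] → M ≤ k
        min′ r = let (_ , le , r′) = Path-[]-transfer (≈-sym e) r in ℕ.≤-trans (min r′) le
    in ¬goal (case ℕ.≤-total a b of λ
      { (inj₁ a≤b) → inj₁ (suffix-match α c e min q₁ (ℕ.≤-trans (ℕ.≤-reflexive eq₂) M′≤M) pc a≤b)
      ; (inj₂ b≤a) → inj₂ (suffix-match β d (≈-sym e) min′ p₁ (ℕ.≤-reflexive eq₁) qd b≤a) })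

  infix 4 _⊑_
  -- The double negation makes the relation stable under common prefixes, since `replace-suffix`
  -- yields no more.
  _⊑_ : Word G → Word G → Set₁
  γ ⊑ δ = ∀ X → R G γ X → ¬ ¬ R G δ X

  -- Deciding the finitely many R γ X keeps the new bisimulation in Set, at the price of ¬ ¬.
  replace-suffix : ∀ {γ δ} → γ ⊑ δ → ∀ {α β} → α ++ γ ≈ β ++ γ → ¬ ¬ (α ++ δ ≈ β ++ δ)
  replace-suffix {γ} {δ} γ⊑δ {α} {β} e = ¬¬-bind (Cont-Fin λ X → decide X) λ d ¬goal → ¬goal (build d)
    where
    decide : ∀ X → ¬ ¬ (Dec (R G γ X) × (R G γ X → R G δ X))
    decide X = ¬¬-bind (¬¬-dec (R G γ X)) λ
      { (yes r) → λ k → γ⊑δ X r λ r′ → k (yes r , λ _ → r′)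
      ; (no ¬r) → λ k → k (no ¬r , λ r → ⊥-elim (¬r r)) }
    build : (∀ X → Dec (R G γ X) × (R G γ X → R G δ X)) → α ++ δ ≈ β ++ δ
    build d = mk≈ {C} symC simC (inj₁ (α , β , refl , refl , B.related))
      where
      module B = SymBisim (un≈ e)
      Red : Word G → Set
      Red = All (λ X → True (proj₁ (d X)))
      red-≈ : ∀ {α} → Red α → α ++ δ ≈ δ
      red-≈ r = letters-≈ (All.map (λ {X} t → proj₂ (d X) (toWitness t)) r)
      red : ∀ α → α ++ γ ≈ γ → Red α
      red α e = All.map (λ {X} r → fromWitness {a? = proj₁ (d X)} r) (≈-letters α e)
      U = union-≈ {Σ (Word G) λ α → Σ (Word G) λ β → Red α × Red β}
            {λ (α , β , _) → α ++ δ} {λ (α , β , _) → β ++ δ}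
            (λ (α , β , r , r′) → ≈-trans (red-≈ r) (≈-sym (red-≈ r′)))
      C : Word G → Word G → Set
      C x y = (Σ (Word G) λ a → Σ (Word G) λ b → x ≡ a ++ δ × y ≡ b ++ δ × B.rel (a ++ γ) (b ++ γ))
            ⊎ proj₁ U x y
      symC : ∀ {x y} → C x y → C y x
      symC (inj₁ (a , b , ea , eb , r)) = inj₁ (b , a , eb , ea , B.rel-sym r)
      symC (inj₂ u) = inj₂ (proj₁ (proj₂ U) u)
      -- Prefixes absorbed by `γ` consist of letters of `R γ`, which `δ` absorbs too, so such pairs
      -- fall into the family `U`.
      erased : ∀ a b → a ++ γ ≈ γ → b ++ γ ≈ γ → Matches G C (a ++ δ) (b ++ δ)
      erased a b ea eb =
        Matches-map inj₂ (proj₁ (proj₂ (proj₂ U)) (proj₂ (proj₂ (proj₂ U)) (a , b , red a ea , red b eb)))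
      simC : Simulation C
      simC (inj₂ u) = Matches-map inj₂ (proj₁ (proj₂ (proj₂ U)) u)
      simC (inj₁ ([] , b , refl , refl , r)) = erased [] b ≈-refl (≈-sym (re≈ (un≈ e) r))
      simC (inj₁ (Y ∷ a , b , refl , refl , r)) c _ (step {α = ρ} ru) with B.rel-sim r c _ (step ru)
      ... | inj₁ (τ , r′) =
        inj₁ (τ , inj₁ (ρ ++ a , b , sym (List.++-assoc ρ a δ) , refl
                       , subst (λ w → B.rel w (b ++ γ)) (sym (List.++-assoc ρ a γ)) r′))
      ... | inj₂ (tₖ , t′ , run , st , r′) with run-split b refl run st
      ...   | inj₁ (bₖ , b′ , run′ , st′ , refl) =
        inj₂ (_ , _ , TauRun-lift δ (λ r → inj₁ (Y ∷ a , _ , refl , refl , r)) run′ , Step-++ δ st′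
             , inj₁ (ρ ++ a , b′ , sym (List.++-assoc ρ a δ) , refl
                    , subst (λ w → B.rel w (b′ ++ γ)) (sym (List.++-assoc ρ a γ)) r′))
      -- The matching run has erased `b` completely, so `Y ∷ a ++ γ` is related to `γ` itself and
      -- both prefixes are absorbed.
      ...   | inj₂ (run′ , _) =
        let r₀ = TauRun-end {P = λ x → B.rel (Y ∷ a ++ γ) (x ++ γ)} r run′
            ea = re≈ (un≈ e) r₀
        in erased (Y ∷ a) b ea (≈-trans (≈-sym (re≈ (un≈ e) r)) ea) c _ (step ru)

-- Runs of transducers

module Runs {n : ℕ} (T : Transducer n) where
  open Transducer T

  state : Fin Q → List (Fin n) → Fin Q
  state q α = proj₁ (run T q α)

  emit : Fin Q → Fin n → List (Fin n)
  emit q X = proj₂ (Δ q X)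

  state-++ : ∀ q α β → state q (α ++ β) ≡ state (state q β) α
  state-++ q []      β = refl
  state-++ q (X ∷ α) β = cong (λ p → proj₁ (Δ p X)) (state-++ q α β)

  out-++ : ∀ q α β → out T q (α ++ β) ≡ out T (state q β) α ++ out T q β
  out-++ q []      β = refl
  out-++ q (X ∷ α) β = begin
    emit (state q (α ++ β)) X ++ out T q (α ++ β)
      ≡⟨ cong₂ (λ p w → emit p X ++ w) (state-++ q α β) (out-++ q α β) ⟩
    emit (state (state q β) α) X ++ (out T (state q β) α ++ out T q β)
      ≡⟨ List.++-assoc (emit (state (state q β) α) X) _ _ ⟨
    out T (state q β) (X ∷ α) ++ out T q β ∎
    where open ≡-Reasoning

  out-[-] : ∀ q X → out T q [ X ] ≡ emit q X
  out-[-] q X = List.++-identityʳ _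

  NormalForm-out-≡ : ∀ q α → NormalForm T q α → out T q α ≡ α
  NormalForm-out-≡ q []      _        = refl
  NormalForm-out-≡ q (X ∷ α) (nf , e) = cong₂ _++_ e (NormalForm-out-≡ q α nf)

  NormalForm-++ : ∀ q α β → NormalForm T (state q β) α → NormalForm T q β → NormalForm T q (α ++ β)
  NormalForm-++ q []      β _        nf′ = nf′
  NormalForm-++ q (X ∷ α) β (nf , e) nf′ =
    NormalForm-++ q α β nf nf′ , trans (cong (λ p → emit p X) (state-++ q α β)) e

  NormalForm? : ∀ q α → Dec (NormalForm T q α)
  NormalForm? q []      = yes tt
  NormalForm? q (X ∷ α) = NormalForm? q α ×-dec List.≡-dec Fin._≟_ _ _

  IsNFC? : Dec (IsNFC T)
  IsNFC? = Fin.all? λ q → Fin.all? λ A →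
    NormalForm? q _ ×-dec ,-≡-dec Fin._≟_ (List.≡-dec Fin._≟_) _ _

  module NFC (nfc : IsNFC T) where

    run-out : ∀ q α → run T q (out T q α) ≡ run T q α
    run-out q []      = refl
    run-out q (X ∷ α) = cong₂ _,_ eq₁ eq₂
      where
      p = state q α
      o = emit p X
      sub : state q (out T q α) ≡ p
      sub = cong proj₁ (run-out q α)
      eq₁ : state q (o ++ out T q α) ≡ proj₁ (Δ p X)
      eq₁ = trans (state-++ q o (out T q α))
        (trans (cong (λ r → state r o) sub) (cong proj₁ (proj₂ (nfc p X))))
      eq₂ : out T q (o ++ out T q α) ≡ o ++ out T q α
      eq₂ = trans (out-++ q o (out T q α))
        (cong₂ _++_ (trans (cong (λ r → out T r o) sub) (cong proj₂ (proj₂ (nfc p X))))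
                    (cong proj₂ (run-out q α)))

    out-≡⇒state-≡ : ∀ q α β → out T q α ≡ out T q β → state q α ≡ state q β
    out-≡⇒state-≡ q α β eq =
      cong proj₁ (trans (sym (run-out q α)) (trans (cong (run T q) eq) (run-out q β)))

    out-[]⇒state : ∀ q α → out T q α ≡ [] → state q α ≡ q
    out-[]⇒state q α eq = out-≡⇒state-≡ q α [] eq

-- Deciding weak steps and consistency

module WeakSteps {n m : ℕ} (G : BPA n m) (T : Transducer n) (nfc : IsNFC T) where
  open BPA G
  open Transducer T
  open Bisimilarity G
  open Runs T
  open NFC nfc

  tau? : ∀ a → Dec (IsTau G a)
  tau? a = Maybe.≡-dec Fin._≟_ tau (just a)

  Rule : (Fin m → Word G → Set) → Fin n → Set
  Rule P X = Σ (Fin m) λ a → Σ (Word G) λ ρ → (X , a , ρ) ∈ rules × P a ρ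

  Rule-map : ∀ {P P′ : Fin m → Word G → Set} {X} → (∀ {a ρ} → P a ρ → P′ a ρ) → Rule P X → Rule P′ X
  Rule-map f (a , ρ , r , p) = a , ρ , r , f p

  Rule? : ∀ {P : Fin m → Word G → Set} → (∀ a ρ → Dec (P a ρ)) → ∀ X → Dec (Rule P X)
  Rule? {P} P? X = map′ to from (any? (λ (Y , a , ρ) → Y Fin.≟ X ×-dec P? a ρ) rules)
    where
    to : Any (λ (Y , a , ρ) → Y ≡ X × P a ρ) rules → Rule P X
    to w with find w
    ... | (_ , a , ρ) , r , refl , p = a , ρ , r , p
    from : Rule P X → Any (λ (Y , a , ρ) → Y ≡ X × P a ρ) rules
    from (a , ρ , r , p) = lose r (refl , p)

  PRun : Fin Q → Word G → Word G → Word G → Set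
  PRun q δ = TauRun G (λ x → out T q x ≡ δ)

  -- Words with empty output do not move the state (`out-[]⇒state`), so all letters of the
  -- right-hand side can be tested in the one state `q`.
  NullStep : Fin Q → (Fin n → Set) → Fin n → Set
  NullStep q P X = emit q X ≡ [] × Rule (λ a ρ → IsTau G a × All P ρ) X

  NullStep-mono : ∀ q {P P′ : Fin n → Set} → (∀ X → P X → P′ X) → ∀ X → NullStep q P X → NullStep q P′ X
  NullStep-mono q f X (e , r) = e , Rule-map (λ (τ , ps) → τ , All.map (f _) ps) r

  NullStep? : ∀ q {P : Fin n → Set} → (∀ X → Dec (P X)) → ∀ X → Dec (NullStep q P X)
  NullStep? q P? X = List.≡-dec Fin._≟_ _ _ ×-dec Rule? (λ a ρ → tau? a ×-dec all? P? ρ) X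

  module Nullable (q : Fin Q) =
    LeastFixpoint (Fin n) n id id (λ _ → refl) (NullStep q) (NullStep-mono q) (NullStep? q)

  Null : Fin Q → Fin n → Set
  Null q = Nullable.lfp q

  Erasable : Fin Q → Fin n → Set
  Erasable q X = emit q X ≡ [] × PRun q [] [ X ] []

  erase-word : ∀ q ρ → All (Erasable q) ρ → out T q ρ ≡ [] × PRun q [] ρ []
  erase-word q []      []              = refl , done
  erase-word q (Z ∷ ρ) ((eZ , rZ) ∷ es) with erase-word q ρ es
  ... | eρ , rρ =
    out≡[]
    , TauRun-++ (TauRun-lift ρ (λ {x} ex → trans (out-++ q x ρ)
        (cong₂ _++_ (trans (cong (λ p → out T p x) sρ) ex) eρ)) rZ) rρ
    where
    sρ : state q ρ ≡ q
    sρ = out-[]⇒state q ρ eρ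
    out≡[] : out T q (Z ∷ ρ) ≡ []
    out≡[] = cong₂ _++_ (trans (cong (λ p → emit p Z) sρ) eZ) eρ

  Null⇒Erasable : ∀ q X → Null q X → Erasable q X
  Null⇒Erasable q = Nullable.lfp-ind q λ X (e , a , ρ , r , τ , es) →
    let (eρ , rρ) = erase-word q ρ es
    in e , more (a , τ , subst (Step G [ X ] a) (List.++-identityʳ ρ) (step r)) eρ rρ

  Null-state : ∀ q ρ → All (Null q) ρ → state q ρ ≡ q × out T q ρ ≡ []
  Null-state q ρ ns =
    let e = proj₁ (erase-word q ρ (All.map (Null⇒Erasable q _) ns)) in out-[]⇒state q ρ e , e

  -- Along a silent run within a class, the acting letter is exposed by erasing the letters to its left.
  Enter : Fin Q → (Fin Q × Fin n → Set) → Word G → Set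
  Enter q P []      = ⊥
  Enter q P (Z ∷ κ) = P (state q κ , Z) ⊎ (Null (state q κ) Z × Enter q P κ)

  Enter-map : ∀ q {P P′ : Fin Q × Fin n → Set} → (∀ s → P s → P′ s) → ∀ ρ → Enter q P ρ → Enter q P′ ρ
  Enter-map q f (Z ∷ κ) (inj₁ p)        = inj₁ (f _ p)
  Enter-map q f (Z ∷ κ) (inj₂ (nul , e)) = inj₂ (nul , Enter-map q f κ e)

  Enter? : ∀ q {P : Fin Q × Fin n → Set} → (∀ s → Dec (P s)) → ∀ ρ → Dec (Enter q P ρ)
  Enter? q P? []      = no id
  Enter? q P? (Z ∷ κ) = P? _ ⊎-dec (Nullable.lfp? _ Z ×-dec Enter? q P? κ)

  Enter-++ : ∀ q {P : Fin Q × Fin n → Set} ρ σ → Enter q P (ρ ++ σ) →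
             Enter (state q σ) P ρ ⊎ (All (Null (state q σ)) ρ × Enter q P σ)
  Enter-++ q []      σ e = inj₂ ([] , e)
  Enter-++ q {P} (Z ∷ ρ) σ (inj₁ p) = inj₁ (inj₁ (subst (λ r → P (r , Z)) (state-++ q ρ σ) p))
  Enter-++ q (Z ∷ ρ) σ (inj₂ (nul , e)) with Enter-++ q ρ σ e
  ... | inj₁ e′ = inj₁ (inj₂ (subst (λ r → Null r Z) (state-++ q ρ σ) nul , e′))
  ... | inj₂ (ns , e′) = inj₂
    (subst (λ r → Null r Z) (trans (state-++ q ρ σ) (proj₁ (Null-state _ ρ ns))) nul ∷ ns , e′)

  module _ (δ : Word G) (a : Fin m) (β : Word G) where

    -- If X is read in state p within a word of output δ, then what is written after emit p X is a suffix
    -- of δ determined by its length.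
    rest : Fin Q → Fin n → Word G
    rest p X = drop (length (emit p X)) δ

    rest-≡ : ∀ q σ X → out T q (X ∷ σ) ≡ δ → rest (state q σ) X ≡ out T q σ
    rest-≡ q σ X refl = drop-length-++ (emit (state q σ) X)

    ActStep : (Fin Q × Fin n → Set) → Fin Q × Fin n → Set
    ActStep P (p , X) = Rule (λ b ρ → b ≡ a × out T p ρ ++ rest p X ≡ β) X
                      ⊎ Rule (λ b ρ → IsTau G b × out T p ρ ≡ emit p X × Enter p P ρ) X

    ActStep-mono : ∀ {P P′ : Fin Q × Fin n → Set} → (∀ s → P s → P′ s) → ∀ s → ActStep P s → ActStep P′ s
    ActStep-mono f s (inj₁ r) = inj₁ r
    ActStep-mono f s (inj₂ r) = inj₂ (Rule-map (λ {_} {ρ} (τ , e , en) → τ , e , Enter-map _ f ρ en) r)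

    ActStep? : ∀ {P : Fin Q × Fin n → Set} → (∀ s → Dec (P s)) → ∀ s → Dec (ActStep P s)
    ActStep? P? (p , X) =
        Rule? (λ b ρ → b Fin.≟ a ×-dec List.≡-dec Fin._≟_ _ _) X
      ⊎-dec Rule? (λ b ρ → tau? b ×-dec (List.≡-dec Fin._≟_ _ _ ×-dec Enter? p P? ρ)) X

    remQuot-combine : ∀ (s : Fin Q × Fin n) → remQuot {Q} n (uncurry combine s) ≡ s
    remQuot-combine (q , X) = Fin.remQuot-combine q X

    module Active = LeastFixpoint (Fin Q × Fin n) (Q * n) (uncurry combine) (remQuot n) remQuot-combine
                      ActStep ActStep-mono ActStep?

    Acts : Fin Q × Fin n → Set
    Acts = Active.lfp

    Result : Fin Q → Word G → Set
    Result q α = Σ (Word G) λ αₖ → Σ (Word G) λ α′ →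
                   PRun q δ α αₖ × Step G αₖ a α′ × out T q α′ ≡ β

    prepend : ∀ {q α α₁} → PRun q δ α α₁ → Result q α₁ → Result q α
    prepend r (αₖ , α′ , r′ , st , e) = αₖ , α′ , TauRun-++ r r′ , st , e

    ResultAt : Fin Q × Fin n → Set
    ResultAt (p , X) = ∀ q σ → state q σ ≡ p → out T q (X ∷ σ) ≡ δ → Result q (X ∷ σ)

    Enter⇒Result : ∀ {p} ρ → Enter p ResultAt ρ →
                   ∀ q σ → state q σ ≡ p → out T q (ρ ++ σ) ≡ δ → Result q (ρ ++ σ)
    Enter⇒Result (Z ∷ κ) (inj₁ res) q σ refl e = res q (κ ++ σ) (state-++ q κ σ) e
    Enter⇒Result (Z ∷ κ) (inj₂ (nul , en)) q σ refl e =
      prepend (TauRun-lift (κ ++ σ) (λ {x} ex → trans (out-++ q x (κ ++ σ))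
                (trans (cong (_++ out T q (κ ++ σ)) (trans (cong (λ r → out T r x) (state-++ q κ σ)) ex)) e′))
                (proj₂ er))
              (Enter⇒Result κ en q σ refl e′)
      where
      er : Erasable (state (state q σ) κ) Z
      er = Null⇒Erasable _ Z nul
      e′ : out T q (κ ++ σ) ≡ δ
      e′ = trans (cong (_++ out T q (κ ++ σ))
             (sym (trans (cong (λ r → emit r Z) (state-++ q κ σ)) (proj₁ er)))) e

    Acts⇒ResultAt : ∀ s → Acts s → ResultAt s
    Acts⇒ResultAt = Active.lfp-ind λ
      { (p , X) (inj₁ (_ , ρ , r , refl , e)) q σ refl eδ →
          X ∷ σ , ρ ++ σ , done , step r
          , trans (out-++ q ρ σ) (trans (cong (out T (state q σ) ρ ++_) (sym (rest-≡ q σ X eδ))) e)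
      ; (p , X) (inj₂ (b , ρ , r , τ , e , en)) q σ refl eδ →
          let eρ = trans (out-++ q ρ σ) (trans (cong (_++ out T q σ) e) eδ)
          in prepend (more (b , τ , step r) eρ done) (Enter⇒Result ρ en q σ refl eρ) }

    Enter⇒WeakStep : ∀ q α → out T q α ≡ δ → Enter q Acts α → Result q α
    Enter⇒WeakStep q α e en = subst (Result q) (List.++-identityʳ α)
      (Enter⇒Result α (Enter-map q Acts⇒ResultAt α en) q [] refl
        (trans (cong (out T q) (List.++-identityʳ α)) e))

    -- Induction on the run. A silent rule keeping the output of the word keeps that of the
    -- rewritten letter, by cancelling the output of `σ`. `Enter-++` then tells whether the acting
    -- letter stems from `ρ`, so that `A` acts, or lies in `σ`, so that all of `ρ` and hence `A` is
    -- nullable.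
    WeakStep⇒Enter : ∀ q {α αₖ α′} → out T q α ≡ δ → PRun q δ α αₖ → Step G αₖ a α′ →
                     out T q α′ ≡ β → Enter q Acts α
    WeakStep⇒Enter q eδ done (step {A} {α = ρ} {β = σ} r) e = inj₁ (Active.lfp-closed _
      (inj₁ (a , ρ , r , refl
            , trans (cong (out T (state q σ) ρ ++_) (rest-≡ q σ A eδ)) (trans (sym (out-++ q ρ σ)) e))))
    WeakStep⇒Enter q eδ (more (b , τ , step {A} {α = ρ} {β = σ} r) p rn) st e
      with List.++-cancelʳ (out T q σ) (out T (state q σ) ρ) (emit (state q σ) A)
             (trans (sym (out-++ q ρ σ)) (trans p (sym eδ)))
         | Enter-++ q ρ σ (WeakStep⇒Enter q p rn st e)
    ... | eρ | inj₁ en = inj₁ (Active.lfp-closed _ (inj₂ (b , ρ , r , τ , eρ , en)))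
    ... | eρ | inj₂ (ns , en) = inj₂
      (Nullable.lfp-closed _ A (trans (sym eρ) (proj₂ (Null-state _ ρ ns)) , b , ρ , r , τ , ns) , en)

  WeakStep? : ∀ q α a β → Dec (WeakStep G T q α a β)
  WeakStep? q α a β = (tau? a ×-dec List.≡-dec Fin._≟_ _ _) ⊎-dec
    map′ (Enter⇒WeakStep (out T q α) a β q α refl)
         (λ (αₖ , α′ , r , st , e) → WeakStep⇒Enter (out T q α) a β q refl r st e)
         (Enter? q (Active.lfp? (out T q α) a β) α)

  -- A weak step that does not idle ends in the output of some right-hand side followed by a suffix
  -- of `δ`. The quantifier over `β` in `Approx` thus becomes finite.
  targets : Word G → List (Word G)
  targets δ = δ ∷ cartesianProductWith (λ p (X , a , ρ) → out T p ρ ++ drop (length (emit p X)) δ) (allFin Q) rules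

  WeakStep-target : ∀ {q α a β} → WeakStep G T q α a β → β ∈ targets (out T q α)
  WeakStep-target (inj₁ (_ , refl)) = here refl
  WeakStep-target {q} {α} {a} (inj₂ (αₖ , _ , r , step {A} {α = ρ} {β = σ} ru , refl)) =
    there (subst (_∈ _)
      (trans (cong (out T (state q σ) ρ ++_) (rest-≡ (out T q α) a [] q σ A (TauRun-end refl r)))
             (sym (out-++ q ρ σ)))
      (∈-cartesianProductWith⁺ (λ p (X , a , ρ) → out T p ρ ++ drop (length (emit p X)) (out T q α))
        (∈-allFin (state q σ)) ru))

  WeakStep-⊆? : ∀ q α₁ α₂ a → Dec (∀ β → WeakStep G T q α₁ a β → WeakStep G T q α₂ a β)
  WeakStep-⊆? q α₁ α₂ a = map′
    (λ all β w → All.lookup all (WeakStep-target w) w)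
    (λ f → All.tabulate λ {β} _ → f β)
    (all? (λ β → WeakStep? q α₁ a β →-dec WeakStep? q α₂ a β) (targets (out T q α₁)))

  Approx? : ∀ q α₁ α₂ → Dec (Approx G T q α₁ α₂)
  Approx? q α₁ α₂ = map′ (λ f a β → proj₁ (f a) β , proj₂ (f a) β)
    (λ f → λ a → (λ β → proj₁ (f a β)) , (λ β → proj₂ (f a β)))
    (Fin.all? λ a → WeakStep-⊆? q α₁ α₂ a ×-dec WeakStep-⊆? q α₂ α₁ a)

  Consistent? : Dec (Consistent G T)
  Consistent? =
    (Fin.all? λ A → List.≡-dec Fin._≟_ _ _ →-dec Approx? q0 [ A ] []) ×-dec
    ((Fin.all? λ q → Fin.all? λ A → ¬? (List.≡-dec Fin._≟_ _ _) →-dec Approx? q [ A ] (out T q [ A ])) ×-dec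
     (Fin.all? λ q → Fin.all? λ A → Fin.all? λ C →
       List.≡-dec Fin._≟_ _ _ →-dec (List.≡-dec Fin._≟_ _ _ →-dec Approx? q (A ∷ C ∷ []) [ C ])))

module NormalForms {n : ℕ} (T : Transducer n) (nfc : IsNFC T) where
  open Transducer T
  open Runs T
  open NFC nfc

  NormalForm-out : ∀ q α → NormalForm T q (out T q α)
  NormalForm-out q []      = tt
  NormalForm-out q (X ∷ α) = NormalForm-++ q (emit (state q α) X) (out T q α)
    (subst (λ p → NormalForm T p (emit (state q α) X)) (sym (cong proj₁ (run-out q α)))
      (subst (NormalForm T (state q α)) (out-[-] (state q α) X) (proj₁ (nfc (state q α) X))))
    (NormalForm-out q α)

-- Soundness of consistent nfc-transducers

module Soundness {n m : ℕ} (G : BPA n m) (T : Transducer n) (nfc : IsNFC T) (con : Consistent G T) where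
  open Transducer T
  open Bisimilarity G
  open Runs T
  open NFC nfc
  open NormalForms T nfc

  WS : Fin Q → Word G → Fin m → Word G → Set
  WS = WeakStep G T

  strong : ∀ q {α a α′} → Step G α a α′ → WS q α a (out T q α′)
  strong q st = inj₂ (_ , _ , done , st , refl)

  lift-WS : ∀ q σ {α a β} → WS (state q σ) α a β → WS q (α ++ σ) a (β ++ out T q σ)
  lift-WS q σ {α} (inj₁ (τ , refl)) = inj₁ (τ , sym (out-++ q α σ))
  lift-WS q σ {α} (inj₂ (αₖ , α′ , r , st , refl)) = inj₂ (_ , _
    , TauRun-lift σ (λ {x} e → trans (out-++ q x σ) (trans (cong (_++ out T q σ) e) (sym (out-++ q α σ)))) r
    , Step-++ σ st , out-++ q α′ σ)

  -- A run that erased `α` and acted in `σ` would pass through `σ` with the output of `α ++ σ`,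
  -- forcing the output of `α` to be empty.
  unlift-WS : ∀ q σ α {a β} → out T (state q σ) α ≢ [] → WS q (α ++ σ) a β →
              Σ (Word G) λ β′ → WS (state q σ) α a β′ × β ≡ β′ ++ out T q σ
  unlift-WS q σ α ne (inj₁ (τ , refl)) = _ , inj₁ (τ , refl) , out-++ q α σ
  unlift-WS q σ α ne (inj₂ (αₖ , α′ , r , st , refl)) with run-split α refl r st
  ... | inj₁ (χ , χ′ , r′ , st′ , refl) = _ ,
    inj₂ (χ , χ′ , TauRun-map (λ {x} e → List.++-cancelʳ (out T q σ) _ _
                     (trans (sym (out-++ q x σ)) (trans e (out-++ q α σ)))) r′ , st′ , refl)
    , out-++ q χ′ σ
  ... | inj₂ (r′ , _) = ⊥-elim (ne (x++y≡y⇒x≡[] _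
    (sym (trans (TauRun-end {P = λ x → out T q (x ++ σ) ≡ out T q (α ++ σ)} refl r′) (out-++ q α σ)))))

  prepend-WS : ∀ q {α α₁ a β} → out T q α₁ ≡ out T q α →
               TauRun G (λ x → out T q x ≡ out T q α) α α₁ → WS q α₁ a β → WS q α a β
  prepend-WS q e r (inj₁ (τ , refl))              = inj₁ (τ , e)
  prepend-WS q e r (inj₂ (αₖ , α′ , r′ , st , e′)) =
    inj₂ (αₖ , α′ , TauRun-++ r (TauRun-map (λ e″ → trans e″ e) r′) , st , e′)

  []-WS : ∀ q {a β} → WS q [] a β → IsTau G a × β ≡ []
  []-WS q (inj₁ w)                      = w
  []-WS q (inj₂ (_ , _ , r , st , _)) = ⊥-elim ([]-no-step r st)

  -- The setting of the third consistency condition: `X` is erased before `σ`, and `C` is the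
  -- leftmost letter of the normal form of `σ`. `recontext` translates between the context `C ∷ η`,
  -- of which the condition sees only `C`, and the actual context `σ`.
  module Redundant (X : Fin n) (σ : Word G) (e : emit (state q0 σ) X ≡ [])
                   (C : Fin n) (η : Word G) (eη : out T q0 σ ≡ C ∷ η) where
    p p′ : Fin Q
    p  = state q0 σ
    p′ = state q0 η

    nf : NormalForm T q0 (C ∷ η)
    nf = subst (NormalForm T q0) eη (NormalForm-out q0 σ)

    out-η : out T q0 η ≡ η
    out-η = NormalForm-out-≡ q0 η (proj₁ nf)

    out-C : out T p′ [ C ] ≡ [ C ]
    out-C = trans (out-[-] p′ C) (proj₂ nf)

    state-C : state p′ [ C ] ≡ p
    state-C = trans (cong (state q0) (sym eη)) (cong proj₁ (run-out q0 σ))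

    out-++C : ∀ x → out T p′ (x ++ [ C ]) ≡ out T p x ++ [ C ]
    out-++C x = trans (out-++ p′ x [ C ]) (cong₂ _++_ (cong (λ r → out T r x) state-C) out-C)

    out-XC : out T p′ (X ∷ C ∷ []) ≡ [ C ]
    out-XC = trans (out-++C [ X ]) (cong (_++ [ C ]) (trans (out-[-] p X) e))

    out-α : out T q0 (X ∷ σ) ≡ C ∷ η
    out-α = trans (cong (_++ out T q0 σ) e) eη

    XC≈C : Approx G T p′ (X ∷ C ∷ []) [ C ]
    XC≈C = proj₂ (proj₂ con) p′ X C out-XC out-C

    recontext : ∀ x → out T p′ (x ++ [ C ]) ++ out T q0 η ≡ out T q0 (x ++ σ)
    recontext x = begin
      out T p′ (x ++ [ C ]) ++ out T q0 η ≡⟨ cong₂ _++_ (out-++C x) out-η ⟩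
      (out T p x ++ [ C ]) ++ η           ≡⟨ List.++-assoc (out T p x) [ C ] η ⟩
      out T p x ++ C ∷ η                  ≡⟨ cong (out T p x ++_) eη ⟨
      out T p x ++ out T q0 σ             ≡⟨ out-++ q0 x σ ⟨
      out T q0 (x ++ σ)                   ∎
      where open ≡-Reasoning

  uncons : ∀ (w : Word G) → w ≡ [] ⊎ Σ (Fin n) λ C → Σ (Word G) λ η → w ≡ C ∷ η
  uncons []      = inj₁ refl
  uncons (C ∷ η) = inj₂ (C , η , refl)

  -- The fate of the leading letter selects the consistency condition: it survives (second), it is
  -- erased and nothing remains (first), or it is erased before a nonempty normal form (third).
  strong-normalise : ∀ {α a α′} → Step G α a α′ → WS q0 (apply T α) a (apply T α′)
  strong-normalise {a = a} (step {X} {α = ρ} {β = σ} r) with List.≡-dec Fin._≟_ (emit (state q0 σ) X) []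
  ... | no ne = subst₂ (λ w w′ → WS q0 w a w′)
      (cong (_++ η) (out-[-] p X))
      (trans (cong₂ _++_ (cong (out T p) (List.++-identityʳ ρ)) (cong proj₂ (run-out q0 σ)))
             (sym (out-++ q0 ρ σ)))
      (lift-WS q0 η (subst (λ q → WS q (out T p [ X ]) a (out T p (ρ ++ []))) (sym (cong proj₁ (run-out q0 σ)))
        (proj₁ (proj₁ (proj₂ con) p X (λ e → ne (trans (sym (out-[-] p X)) e)) a _) (strong p (step r)))))
    where
    p = state q0 σ
    η = out T q0 σ
  ... | yes e with uncons (out T q0 σ)
  ...   | inj₁ eη = subst₂ (λ w w′ → WS q0 w a w′)
      (sym (cong₂ _++_ e eη))
      (trans (cong (out T q0) (List.++-identityʳ ρ))
        (sym (trans (out-++ q0 ρ σ)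
          (trans (cong₂ (λ q w → out T q ρ ++ w) (out-[]⇒state q0 σ eη) eη) (List.++-identityʳ _)))))
      (proj₁ (proj₁ con X (trans (out-[-] q0 X)
                            (subst (λ q → emit q X ≡ []) (out-[]⇒state q0 σ eη) e)) a _)
        (strong q0 (step r)))
  ...   | inj₂ (C , η , eη) = subst₂ (λ w w′ → WS q0 w a w′)
      (sym (cong₂ _++_ e eη))
      (recontext ρ)
      (lift-WS q0 η (proj₁ (XC≈C a _) (strong p′ (step r))))
    where open Redundant X σ e C η eη

  unnormalise : ∀ α {a β} → WS q0 (apply T α) a β → WS q0 α a β
  unnormalise [] w = w
  unnormalise (X ∷ σ) {a} {β} w with List.≡-dec Fin._≟_ (emit (state q0 σ) X) []
  ... | no ne =
    let (β′ , w′ , eβ) = unlift-WS q0 η (emit p X)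
          (λ e → ne (trans (sym (cong proj₂ (proj₂ (nfc p X))))
                           (trans (cong (λ q → out T q (emit p X)) (sym sη)) e))) w
        w″ = proj₂ (proj₁ (proj₂ con) p X (λ e → ne (trans (sym (out-[-] p X)) e)) a β′)
               (subst₂ (λ q v → WS q v a β′) sη (sym (out-[-] p X)) w′)
    in subst (WS q0 (X ∷ σ) a) (trans (cong (β′ ++_) (sym (cong proj₂ (run-out q0 σ)))) (sym eβ))
         (lift-WS q0 σ w″)
    where
    p = state q0 σ
    η = out T q0 σ
    sη : state q0 η ≡ p
    sη = cong proj₁ (run-out q0 σ)
  ... | yes e with uncons (out T q0 σ)
  ...   | inj₁ eη = let (τ , eβ) = []-WS q0 (subst (λ v → WS q0 v a β) (cong₂ _++_ e eη) w)
               in inj₁ (τ , trans eβ (sym (cong₂ _++_ e eη)))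
  ...   | inj₂ (C , η , eη) with unlift-WS q0 η [ C ] (λ e′ → contradiction (trans (sym out-C) e′) λ ())
                     (subst (λ v → WS q0 v a β) (cong₂ _++_ e eη) w)
    where open Redundant X σ e C η eη
  ...     | β′ , w′ , eβ with proj₂ (XC≈C a β′) w′
    where open Redundant X σ e C η eη
  ...       | inj₁ (τ , eβ′) =
    inj₁ (τ , trans eβ (trans (cong₂ _++_ (trans eβ′ out-XC) out-η) (sym out-α)))
    where open Redundant X σ e C η eη
  ...       | inj₂ (αₖ , α′ , r , st , refl) with run-split [ X ] refl r st
  ...         | inj₁ (χ , χ′ , r′ , st′ , refl) = inj₂ (_ , _
      , TauRun-lift σ (λ {x} ex → trans (sym (recontext x))
                         (trans (cong (_++ out T q0 η) ex) (recontext [ X ]))) r′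
      , Step-++ σ st′ , trans (sym (recontext χ′)) (sym eβ))
    where open Redundant X σ e C η eη
  -- `X` is erased silently before `C` moves. The erasing run is replayed in front of `σ`, whose
  -- normal form is that of the whole word, and the recursion handles `σ`.
  ...         | inj₂ (r′ , _) = prepend-WS q0 (trans eη (sym out-α))
      (TauRun-lift σ (λ {x} ex → trans (sym (recontext x))
                         (trans (cong (_++ out T q0 η) ex) (recontext [ X ]))) r′)
      (unnormalise σ (subst (λ v → WS q0 v a β) (cong (_++ out T q0 σ) e) w))
    where open Redundant X σ e C η eη

  sound : ∀ α β → apply T α ≡ apply T β → α ≈ β
  sound α β eq = mk≈ {λ x y → apply T x ≡ apply T y} sym sim eq
    where
    sim : Simulation (λ x y → apply T x ≡ apply T y)
    sim {x} {y} e a x′ st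
      with unnormalise y (subst (λ v → WS q0 v a (apply T x′)) e (strong-normalise st))
    ... | inj₁ (τ , e′) = inj₁ (τ , e′)
    ... | inj₂ (yₖ , y′ , r , st′ , e′) = inj₂ (yₖ , y′ , TauRun-map (λ e″ → trans e (sym e″)) r , st′ , sym e′)

-- An exponential bound on norms

module NormBound {n m : ℕ} (G : BPA n m) (normed : Normed G) where
  open BPA G
  open Bisimilarity G
  open Norms G normed

  Derive : (Fin n → Set) → Fin n → Set
  Derive P X = Any (λ (Y , a , ρ) → Y ≡ X × All P ρ) rules

  Derive-mono : ∀ {P P′ : Fin n → Set} → (∀ X → P X → P′ X) → ∀ X → Derive P X → Derive P′ X
  Derive-mono f X = Any.map (λ (e , ps) → e , All.map (f _) ps)

  Derive? : ∀ {P : Fin n → Set} → (∀ X → Dec (P X)) → ∀ X → Dec (Derive P X)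
  Derive? P? X = any? (λ (Y , a , ρ) → Y Fin.≟ X ×-dec all? P? ρ) rules

  -- approx k X says that X has a derivation tree of height at most k; height n always suffices.
  open LeastFixpoint (Fin n) n id id (λ _ → refl) Derive Derive-mono Derive? using (approx; lfp; lfp-closed)

  Steps⇒lfp : ∀ {α} → Steps G α [] → All lfp α
  Steps⇒lfp done = []
  Steps⇒lfp (more (step {A} {α = ρ} r) rs) with Steps⇒lfp rs
  ... | ps = lfp-closed A (lose r (refl , All.++⁻ˡ ρ ps)) ∷ All.++⁻ʳ ρ ps

  g : ℕ
  g = sizeBPA G

  rule-length : ∀ {A a ρ} → (A , a , ρ) ∈ rules → length ρ ≤ g
  rule-length r = ℕ.≤-trans (go r) (ℕ.m≤n+m _ (n + m))
    where
    go : ∀ {rs : List (Fin n × Fin m × Word G)} {A a ρ} → (A , a , ρ) ∈ rs →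
         length ρ ≤ sum (map (λ r → 2 + length (proj₂ (proj₂ r))) rs)
    go (here refl) = ℕ.≤-trans (ℕ.m≤n+m _ 2) (ℕ.m≤m+n _ _)
    go (there r)   = ℕ.≤-trans (go r) (ℕ.m≤n+m _ _)

  ShortPath : ℕ → Word G → Set₁
  ShortPath b α = Σ ℕ λ l → l ≤ b × Path α l []

  short-word : ∀ {b α} → All (λ X → ShortPath b [ X ]) α → ShortPath (length α * b) α
  short-word [] = 0 , z≤n , nil
  short-word {α = X ∷ α} ((l , l≤ , p) ∷ ps) =
    let (k , k≤ , q) = short-word ps in l + k , ℕ.+-mono-≤ l≤ k≤ , Path-trans (Path-++ α p) q

  -- After one rule at most `g` letters remain, each of weight at most `suc g ^ k`; the rule itself
  -- is paid for by `1 ≤ suc g ^ k`.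
  approx⇒short : ∀ k X → approx k X → ShortPath (suc g ^ k) [ X ]
  approx⇒short (suc k) X d with find d
  ... | (_ , a , ρ) , r , refl , ps with short-word (All.map (λ {Y} → approx⇒short k Y) ps)
  ...   | l , l≤ , p = suc l
    , ℕ.+-mono-≤ (ℕ.m^n>0 (suc g) k) (ℕ.≤-trans l≤ (ℕ.*-monoˡ-≤ (suc g ^ k) (rule-length r)))
    , decr (step r) (subst (λ w → Path w l []) (sym (List.++-identityʳ ρ)) p)

  normBound : ℕ
  normBound = suc g ^ n

  short-norm : ∀ X → ShortPath normBound [ X ]
  short-norm X = approx⇒short n X (All.head (Steps⇒lfp (normed X)))

-- Orders on words

module Lexicographic {n m : ℕ} (G : BPA n m) (_<V_ : Rel (Fin n) 0ℓ) (sto : IsStrictTotalOrder _≡_ _<V_) where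
  open IsStrictTotalOrder sto using (compare; isEquivalence; <-resp-≈) renaming (trans to <V-trans; irrefl to <V-irrefl)

  infix 4 _<L_
  _<L_ : Rel (Word G) 0ℓ
  _<L_ = Lex.Lex-< _≡_ _<V_

  infix 4 _≺_
  -- `LexLt` compares from the right; on reversed words it is the usual lexicographic order, proper
  -- suffixes becoming proper prefixes.
  _≺_ : Rel (Word G) 0ℓ
  α ≺ β = reverse α <L reverse β

  ≺-trans : ∀ α β γ → α ≺ β → β ≺ γ → α ≺ γ
  ≺-trans _ _ _ = Lex.<-transitive isEquivalence <-resp-≈ <V-trans

  ≺-irrefl : ∀ α → ¬ α ≺ α
  ≺-irrefl α = Lex.<-irreflexive <V-irrefl (≡⇒Pointwise-≡ {x = reverse α} refl)

  ≺-compare : ∀ α β → α ≡ β ⊎ α ≺ β ⊎ β ≺ α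
  ≺-compare α β with Lex.<-compare sym compare (reverse α) (reverse β)
  ... | tri< lt _ _ = inj₂ (inj₁ lt)
  ... | tri≈ _ eq _ = inj₁ (List.reverse-injective (Pointwise-≡⇒≡ eq))
  ... | tri> _ _ gt = inj₂ (inj₂ gt)

  reverse-around : ∀ (α : Word G) A γ → reverse (α ++ A ∷ γ) ≡ reverse γ ++ A ∷ reverse α
  reverse-around α A γ = begin
    reverse (α ++ A ∷ γ)             ≡⟨ List.reverse-++ α (A ∷ γ) ⟩
    reverse (A ∷ γ) ++ reverse α     ≡⟨ cong (_++ reverse α) (List.unfold-reverse A γ) ⟩
    (reverse γ ++ [ A ]) ++ reverse α ≡⟨ List.++-assoc (reverse γ) [ A ] (reverse α) ⟩
    reverse γ ++ A ∷ reverse α       ∎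
    where open ≡-Reasoning

  <L-++ : ∀ π {xs ys : Word G} → xs <L ys → π ++ xs <L π ++ ys
  <L-++ []      lt = lt
  <L-++ (x ∷ π) lt = next refl (<L-++ π lt)

  <L-++⁻ : ∀ π {xs ys : Word G} → π ++ xs <L π ++ ys → xs <L ys
  <L-++⁻ []      lt          = lt
  <L-++⁻ (x ∷ π) (this x<x)  = ⊥-elim (<V-irrefl refl x<x)
  <L-++⁻ (x ∷ π) (next _ lt) = <L-++⁻ π lt

  LexLt⇒≺ : ∀ {α β} → LexLt G _<V_ α β → α ≺ β
  LexLt⇒≺ {α} (inj₁ ([] , ne , refl)) = ⊥-elim (ne refl)
  LexLt⇒≺ {α} (inj₁ (X ∷ δ , ne , refl)) =
    subst₂ _<L_ (List.++-identityʳ (reverse α)) (sym (List.reverse-++ (X ∷ δ) α))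
      (<L-++ (reverse α) (subst ([] <L_) (sym (List.unfold-reverse X δ)) ([]<snoc (reverse δ))))
    where
    []<snoc : ∀ xs {x} → [] <L (xs ++ [ x ])
    []<snoc []       = halt
    []<snoc (_ ∷ _) = halt
  LexLt⇒≺ (inj₂ (α′ , β′ , A , B , γ , refl , refl , A<B)) =
    subst₂ _<L_ (sym (reverse-around α′ A γ)) (sym (reverse-around β′ B γ)) (<L-++ (reverse γ) (this A<B))

  ≺⇒LexLt : ∀ {α β} → α ≺ β → LexLt G _<V_ α β
  ≺⇒LexLt {α} {β} lt = subst₂ (LexLt G _<V_) (List.reverse-involutive α) (List.reverse-involutive β) (go lt)
    where
    extend : ∀ X xs ys → LexLt G _<V_ (reverse xs) (reverse ys) →
             LexLt G _<V_ (reverse (X ∷ xs)) (reverse (X ∷ ys))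
    extend X xs ys l rewrite List.unfold-reverse X xs | List.unfold-reverse X ys with l
    ... | inj₁ (δ , ne , e) = inj₁ (δ , ne , trans (cong (_++ [ X ]) e) (List.++-assoc δ (reverse xs) [ X ]))
    ... | inj₂ (α′ , β′ , A , B , γ , e , e′ , A<B) = inj₂ (α′ , β′ , A , B , γ ++ [ X ]
        , trans (cong (_++ [ X ]) e) (List.++-assoc α′ (A ∷ γ) [ X ])
        , trans (cong (_++ [ X ]) e′) (List.++-assoc β′ (B ∷ γ) [ X ]) , A<B)
    go : ∀ {xs ys} → xs <L ys → LexLt G _<V_ (reverse xs) (reverse ys)
    go (base ())
    go (halt {y} {ys}) = inj₁ (reverse (y ∷ ys)
      , (λ e → contradiction (List.++-conicalʳ (reverse ys) [ y ] (trans (sym (List.unfold-reverse y ys)) e)) λ ())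
      , sym (List.++-identityʳ _))
    go (this {x} {xs} {y} {ys} x<y) =
      inj₂ (reverse xs , reverse ys , x , y , [] , List.unfold-reverse x xs , List.unfold-reverse y ys , x<y)
    go (next {x} {xs} {_} {ys} refl lt) = extend x xs ys (go lt)

  LexLt-letter : ∀ (α : Word G) {B C σ} → LexLt G _<V_ (α ++ B ∷ σ) (α ++ C ∷ σ) → B <V C
  LexLt-letter α {B} {C} {σ} lt = head<
    (<L-++⁻ (reverse σ) (subst₂ _<L_ (reverse-around α B σ) (reverse-around α C σ) (LexLt⇒≺ lt)))
    where
    head< : B ∷ reverse α <L C ∷ reverse α → B <V C
    head< (this B<C)  = B<C
    head< (next _ lt) = ⊥-elim (≺-irrefl α lt)

  -- Canonical outputs are the least candidates for this order: longest first, then lexicographic.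
  infix 4 _≼_
  _≼_ : Rel (Word G) 0ℓ
  α ≼ β = length β < length α ⊎ (length α ≡ length β × (α ≡ β ⊎ α ≺ β))

  ≼-refl : ∀ α → α ≼ α
  ≼-refl α = inj₂ (refl , inj₁ refl)

  ≼-total : ∀ α β → α ≼ β ⊎ β ≼ α
  ≼-total α β with ℕ.<-cmp (length α) (length β)
  ... | tri< lt _ _ = inj₂ (inj₁ lt)
  ... | tri> _ _ gt = inj₁ (inj₁ gt)
  ... | tri≈ _ eq _ with ≺-compare α β
  ...   | inj₁ e        = inj₁ (inj₂ (eq , inj₁ e))
  ...   | inj₂ (inj₁ l) = inj₁ (inj₂ (eq , inj₂ l))
  ...   | inj₂ (inj₂ g) = inj₂ (inj₂ (sym eq , inj₂ g))

  ≼-trans : ∀ α β γ → α ≼ β → β ≼ γ → α ≼ γ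
  ≼-trans α β γ (inj₁ l)        (inj₁ l′)       = inj₁ (ℕ.<-trans l′ l)
  ≼-trans α β γ (inj₁ l)        (inj₂ (eq , _)) = inj₁ (subst (_< length α) eq l)
  ≼-trans α β γ (inj₂ (eq , _)) (inj₁ l)        = inj₁ (subst (length γ <_) (sym eq) l)
  ≼-trans α β γ (inj₂ (eq , inj₁ refl)) (inj₂ q) = inj₂ q
  ≼-trans α β γ (inj₂ (eq , inj₂ l)) (inj₂ (eq′ , inj₁ refl)) = inj₂ (eq , inj₂ l)
  ≼-trans α β γ (inj₂ (eq , inj₂ l)) (inj₂ (eq′ , inj₂ l′)) = inj₂ (trans eq eq′ , inj₂ (≺-trans α β γ l l′))

  least : ∀ {p} {P : Word G → Set p} {αs} → All (λ α → Dec (P α)) αs →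
          (Σ (Word G) λ α → P α × (∀ {β} → β ∈ αs → P β → α ≼ β)) ⊎ (∀ {β} → β ∈ αs → ¬ P β)
  least [] = inj₂ λ ()
  least {αs = α ∷ αs} (P? ∷ Ps?) with P? | least Ps?
  ... | no ¬p | inj₁ (β , q , min) = inj₁ (β , q , λ { (here refl) p → ⊥-elim (¬p p) ; (there i) → min i })
  ... | no ¬p | inj₂ none          = inj₂ λ { (here refl) → ¬p ; (there i) → none i }
  ... | yes p | inj₂ none          = inj₁ (α , p , λ { (here refl) _ → ≼-refl α ; (there i) q → ⊥-elim (none i q) })
  ... | yes p | inj₁ (β , q , min) with ≼-total α β
  ...   | inj₁ α≼β = inj₁ (α , p , λ { (here refl) _ → ≼-refl α
                                     ; {γ} (there i) r → ≼-trans α β γ α≼β (min i r) })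
  ...   | inj₂ β≼α = inj₁ (β , q , λ { (here refl) _ → β≼α ; (there i) → min i })

-- Canonical outputs, normal forms and consistency

module Canonicity {n m : ℕ} (G : BPA n m) (normed : Normed G)
  (_<V_ : Rel (Fin n) 0ℓ) (sto : IsStrictTotalOrder _≡_ _<V_) where
  open Bisimilarity G
  open Norms G normed
  open Lexicographic G _<V_ sto
  open IsStrictTotalOrder sto using () renaming (irrefl to <V-irrefl; asym to <V-asym)

  infix 4 _≎_
  _≎_ : Word G → Word G → Set₁
  γ ≎ δ = γ ⊑ δ × δ ⊑ γ

  ≎-sym : ∀ {γ δ} → γ ≎ δ → δ ≎ γ
  ≎-sym (le , ge) = ge , le

  ≎-refl : ∀ {γ} → γ ≎ γ
  ≎-refl = (λ X r k → k r) , (λ X r k → k r)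

  ≎-trans : ∀ {γ δ ε} → γ ≎ δ → δ ≎ ε → γ ≎ ε
  ≎-trans (le , ge) (le′ , ge′) = (λ X r → ¬¬-bind (le X r) (le′ X)) , (λ X r → ¬¬-bind (ge′ X r) (ge X))

  ≎-++ : ∀ α {γ δ} → γ ≎ δ → α ++ γ ≎ α ++ δ
  ≎-++ α (le , ge) = (λ X → replace-suffix le {X ∷ α} {α}) , (λ X → replace-suffix ge {X ∷ α} {α})

  ≈⇒≎ : ∀ {γ δ} → γ ≈ δ → γ ≎ δ
  ≈⇒≎ e = (λ X r k → k (≈-trans (≈-++ˡ [ X ] (≈-sym e)) (≈-trans r e)))
        , (λ X r k → k (≈-trans (≈-++ˡ [ X ] e) (≈-trans r (≈-sym e))))

  RF-⊑ : ∀ {γ δ} → γ ⊑ δ → ∀ {α} → RF α δ → RF α γ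
  RF-⊑ le []                 = []
  RF-⊑ le {X ∷ α} (¬e ∷ rf) = (λ e → replace-suffix le {X ∷ α} {α} e ¬e) ∷ RF-⊑ le rf

  mkCand : ∀ {A γ α} → α ++ γ ≈ A ∷ γ → RF α γ → Cand G _<V_ A γ α
  mkCand e rf = e , RF⇒RedundancyFree rf

  Cand-RF : ∀ {A γ α} → Cand G _<V_ A γ α → RF α γ
  Cand-RF (_ , rf) = RedundancyFree⇒RF rf

  reduce : ∀ δ γ → ¬ ¬ (Σ (Word G) λ δ′ → RF δ′ γ × δ′ ++ γ ≈ δ ++ γ)
  reduce []      γ = λ k → k ([] , [] , ≈-refl)
  reduce (X ∷ δ) γ = ¬¬-bind (reduce δ γ) λ (δ′ , rf , e) → ¬¬-bind (¬¬-dec (X ∷ δ′ ++ γ ≈ δ′ ++ γ)) λ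
    { (yes r) k → k (δ′ , rf , ≈-trans (≈-sym r) (≈-++ˡ [ X ] e))
    ; (no ¬r) k → k (X ∷ δ′ , ¬r ∷ rf , ≈-++ˡ [ X ] e) }

  length≤1 : ∀ (δ : Word G) {A} → length (δ ++ [ A ]) ≤ 1 → δ ≡ []
  length≤1 []      _ = refl
  length≤1 (X ∷ δ) (s≤s le) =
    contradiction (ℕ.≤-trans (++-length-≤ δ) le) λ ()

  -- Once `δ` is made redundancy-free before `A ∷ γ`, appending `A` gives a candidate for `B`. Since
  -- the canonical output of `B` has length 1, nothing is left of `δ`.
  collapse : ∀ {A B γ} δ → CanonOut G _<V_ A γ [ A ] → CanonOut G _<V_ B γ [ B ] →
             δ ++ A ∷ γ ≈ B ∷ γ → ¬ ¬ (A ∷ γ ≈ B ∷ γ)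
  collapse {A} {B} {γ} δ (candA , _) (_ , longest , _) e = ¬¬-bind (reduce δ (A ∷ γ)) λ (δ′ , rf , e′) k →
    let e″ = ≈-trans e′ e
        δ′≡[] = length≤1 δ′ (longest (δ′ ++ [ A ])
          (mkCand (≈-trans (≈-reflexive (List.++-assoc δ′ [ A ] γ)) e″) (RF-++⁺ rf (Cand-RF candA))))
    in k (subst (λ w → w ++ A ∷ γ ≈ B ∷ γ) δ′≡[] e″)

  least-letter : ∀ {A B γ} → CanonOut G _<V_ A γ [ A ] → CanonOut G _<V_ B γ [ B ] →
                 A ∷ γ ≈ B ∷ γ → ¬ A <V B
  least-letter (candA , _) (_ , _ , least) e A<B with least _ (mkCand e (Cand-RF candA)) refl
  ... | inj₁ refl = <V-irrefl refl A<B
  ... | inj₂ lt   = <V-asym A<B (LexLt-letter [] lt)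

  -- State q stands for the set R (rep q).
  record Canonical : Set₁ where
    field
      T        : Transducer n
    open Transducer T public
    field
      rep      : Fin Q → Word G
      rep-q0   : rep q0 ≡ []
      target   : ∀ q A → rep (proj₁ (Δ q A)) ≎ A ∷ rep q
      output   : ∀ q A → CanonOut G _<V_ A (rep q) (proj₂ (Δ q A))
      distinct : ∀ q q′ → rep q ≎ rep q′ → q ≡ q′
      Q-bound  : Q ≤ 2 ^ n

  module Properties (C : Canonical) where
    open Canonical C
    open Runs T

    rep-state : ∀ q α → rep (state q α) ≎ α ++ rep q
    rep-state q []      = ≎-refl
    rep-state q (X ∷ α) = ≎-trans (target (state q α) X) (≎-++ [ X ] (rep-state q α))

    out-≈ : ∀ q α → ¬ ¬ (out T q α ++ rep q ≈ α ++ rep q)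
    out-≈ q [] k = k ≈-refl
    out-≈ q (X ∷ α) = ¬¬-bind (out-≈ q α) λ ih →
      ¬¬-bind (replace-suffix (proj₁ (rep-state q α)) {emit (state q α) X} {[ X ]}
                (proj₁ (proj₁ (output (state q α) X)))) λ e k →
      k (≈-trans (≈-reflexive (List.++-assoc (emit (state q α) X) (out T q α) (rep q)))
          (≈-trans (≈-++ˡ (emit (state q α) X) ih) e))

    -- A letter inside a canonical output is its own canonical output: anything longer or smaller
    -- could be substituted for it.
    emit-inside : ∀ {A γ p} α B σ → rep p ≎ σ ++ γ → CanonOut G _<V_ A γ (α ++ B ∷ σ) → emit p B ≡ [ B ]
    emit-inside {A} {γ} {p} α B σ p≎ (cand , longest , least) =
      decidable-stable (List.≡-dec Fin._≟_ _ _) (¬¬-bind oγ₁≈ λ e k → k (main e))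
      where
      γ₁ o : Word G
      γ₁ = σ ++ γ
      o  = emit p B
      rf : RF α (B ∷ γ₁) × RF (B ∷ σ) γ
      rf = RF-++⁻ α (Cand-RF cand)
      rfσ : RF σ γ
      rfσ with proj₂ rf
      ... | _ ∷ r = r
      ¬redB : ¬ (B ∷ γ₁ ≈ γ₁)
      ¬redB with proj₂ rf
      ... | r ∷ _ = r
      oγ₁≈ : ¬ ¬ (o ++ γ₁ ≈ B ∷ γ₁)
      oγ₁≈ = replace-suffix (proj₁ p≎) {o} {[ B ]} (proj₁ (proj₁ (output p B)))
      1≤o : 1 ≤ length o
      1≤o = proj₁ (proj₂ (output p B)) [ B ] (mkCand ≈-refl (RF-⊑ (proj₁ p≎) (¬redB ∷ [])))
      rfo : RF o γ₁
      rfo = RF-⊑ (proj₂ p≎) (Cand-RF (proj₁ (output p B)))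
      candidate : o ++ γ₁ ≈ B ∷ γ₁ → Cand G _<V_ A γ (α ++ (o ++ σ))
      candidate e = mkCand
        (≈-trans (≈-reflexive (trans (List.++-assoc α (o ++ σ) γ) (cong (α ++_) (List.++-assoc o σ γ))))
          (≈-trans (≈-++ˡ α e) (≈-trans (≈-reflexive (sym (List.++-assoc α (B ∷ σ) γ))) (proj₁ cand))))
        (RF-++⁺ (subst (RF α) (sym (List.++-assoc o σ γ)) (RF-≈ (≈-sym e) (proj₁ rf))) (RF-++⁺ rfo rfσ))
      o≤1 : o ++ γ₁ ≈ B ∷ γ₁ → length o ≤ 1
      o≤1 e = ℕ.+-cancelʳ-≤ (length σ) (length o) 1
        (subst (_≤ suc (length σ)) (List.length-++ o)
          (ℕ.+-cancelˡ-≤ (length α) _ _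
            (subst₂ _≤_ (List.length-++ α) (List.length-++ α) (longest _ (candidate e)))))
      single : ∀ (w : Word G) → 1 ≤ length w → length w ≤ 1 → Σ (Fin n) λ C → w ≡ [ C ]
      single (C ∷ [])     _ _        = C , refl
      single (_ ∷ _ ∷ _)  _ (s≤s ())
      main : o ++ γ₁ ≈ B ∷ γ₁ → o ≡ [ B ]
      main e with single o 1≤o (o≤1 e)
      ... | C , o≡ = trans o≡ (cong [_] (sym B≡C))
        where
        candC : Cand G _<V_ A γ (α ++ C ∷ σ)
        candC = subst (λ w → Cand G _<V_ A γ (α ++ (w ++ σ))) o≡ (candidate e)
        B≤C : B ≡ C ⊎ B <V C
        B≤C with least _ candC (trans (List.length-++ α) (sym (List.length-++ α)))
        ... | inj₁ eq = inj₁ (List.∷-injectiveˡ (List.++-cancelˡ α _ _ eq))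
        ... | inj₂ lt = inj₂ (LexLt-letter α lt)
        C≤B : [ C ] ≡ [ B ] ⊎ LexLt G _<V_ [ C ] [ B ]
        C≤B = subst (λ w → w ≡ [ B ] ⊎ LexLt G _<V_ w [ B ]) o≡
          (proj₂ (proj₂ (output p B)) [ B ] (mkCand ≈-refl (RF-⊑ (proj₁ p≎) (¬redB ∷ []))) (cong length (sym o≡)))
        B≡C : B ≡ C
        B≡C with B≤C | C≤B
        ... | inj₁ eq | _         = eq
        ... | inj₂ lt | inj₁ refl = refl
        ... | inj₂ lt | inj₂ gt   = ⊥-elim (<V-asym lt (LexLt-letter [] gt))

    emit-NormalForm : ∀ q A → NormalForm T q (emit q A)
    emit-NormalForm q A = go [] (emit q A) refl
      where
      go : ∀ α σ → emit q A ≡ α ++ σ → NormalForm T q σ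
      go α []      eq = tt
      go α (B ∷ σ) eq = go (α ++ [ B ]) σ (trans eq (sym (List.++-assoc α [ B ] σ)))
        , emit-inside α B σ (rep-state q σ) (subst (CanonOut G _<V_ A (rep q)) eq (output q A))

    nfc : IsNFC T
    nfc q A = subst (NormalForm T q) (sym (out-[-] q A)) (emit-NormalForm q A)
            , cong₂ _,_ (distinct _ _ (≎-trans (rep-state q (emit q A))
                           (≎-trans (≈⇒≎ (proj₁ (proj₁ (output q A)))) (≎-sym (target q A)))))
                        (NormalForm-out-≡ q (emit q A) (emit-NormalForm q A))

    open NFC nfc
    open NormalForms T nfc
    open WeakSteps G T nfc

    NormalForm-RF : ∀ q α → NormalForm T q α → RF α (rep q)
    NormalForm-RF q []      _        = []
    NormalForm-RF q (X ∷ α) (nf , e) with RF-⊑ (proj₂ (rep-state q α))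
      (Cand-RF (subst (Cand G _<V_ X (rep (state q α))) e (proj₁ (output (state q α) X))))
    ... | ¬e ∷ _ = ¬e ∷ NormalForm-RF q α nf

    NormalForm-suffix : ∀ q α {β} → NormalForm T q (α ++ β) → NormalForm T q β
    NormalForm-suffix q []      nf       = nf
    NormalForm-suffix q (X ∷ α) (nf , _) = NormalForm-suffix q α nf

    NormalForm-output : ∀ q α A γ → NormalForm T q (α ++ A ∷ γ) → CanonOut G _<V_ A (rep (state q γ)) [ A ]
    NormalForm-output q α A γ nf =
      subst (CanonOut G _<V_ A _) (proj₂ (NormalForm-suffix q α nf)) (output (state q γ) A)

    -- In the suffix case the surplus prefix would be absorbed, against redundancy-freeness.
    -- Otherwise the words part at `A` and `B` above a common `γ`. Comparability, moved to the
    -- representative of the state reached after `γ`, lets `collapse` make the two letters bisimilar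
    -- there, and then the smaller `A` contradicts the choice of `B` as its own canonical output.
    ≈-not-LexLt : ∀ q {α β} → NormalForm T q α → NormalForm T q β → α ++ rep q ≈ β ++ rep q →
                  ¬ LexLt G _<V_ α β
    ≈-not-LexLt q {α} {β} nfα nfβ e (inj₁ (δ , ne , refl)) =
      ne (RF-≈⇒[] (proj₁ (RF-++⁻ δ (NormalForm-RF q β nfβ)))
           (≈-trans (≈-reflexive (sym (List.++-assoc δ α (rep q)))) (≈-sym e)))
    ≈-not-LexLt q nfα nfβ e (inj₂ (α′ , β′ , A , B , γ , refl , refl , A<B)) =
      suffixes-comparable α′ β′ (A ∷ γ₁) (B ∷ γ₁)
        (subst₂ _≈_ (List.++-assoc α′ (A ∷ γ) (rep q)) (List.++-assoc β′ (B ∷ γ) (rep q)) e) λ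
        { (inj₁ (δ , e′)) → shift δ A B e′ λ e″ →
            collapse δ outA outB e″ λ r → least-letter outA outB r A<B
        ; (inj₂ (δ , e′)) → shift δ B A e′ λ e″ →
            collapse δ outB outA e″ λ r → least-letter outA outB (≈-sym r) A<B }
      where
      γ₁ ρ : Word G
      γ₁ = γ ++ rep q
      ρ  = rep (state q γ)
      outA = NormalForm-output q α′ A γ nfα
      outB = NormalForm-output q β′ B γ nfβ
      shift : ∀ δ C D → δ ++ C ∷ γ₁ ≈ D ∷ γ₁ → ¬ ¬ (δ ++ C ∷ ρ ≈ D ∷ ρ)
      shift δ C D e = ¬¬-bind
        (replace-suffix (proj₂ (rep-state q γ)) {δ ++ [ C ]} {[ D ]}
          (≈-trans (≈-reflexive (List.++-assoc δ [ C ] γ₁)) e))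
        λ e′ k → k (≈-trans (≈-reflexive (sym (List.++-assoc δ [ C ] ρ))) e′)

    NormalForm-unique : ∀ q {α β} → NormalForm T q α → NormalForm T q β → α ++ rep q ≈ β ++ rep q → α ≡ β
    NormalForm-unique q {α} {β} nfα nfβ e with ≺-compare α β
    ... | inj₁ eq        = eq
    ... | inj₂ (inj₁ lt) = ⊥-elim (≈-not-LexLt q nfα nfβ e (≺⇒LexLt lt))
    ... | inj₂ (inj₂ gt) = ⊥-elim (≈-not-LexLt q nfβ nfα (≈-sym e) (≺⇒LexLt gt))

    out-complete : ∀ q {α β} → ¬ ¬ (α ++ rep q ≈ β ++ rep q) → out T q α ≡ out T q β
    out-complete q {α} {β} ¬¬e = decidable-stable (List.≡-dec Fin._≟_ _ _)
      (¬¬-bind ¬¬e λ e → ¬¬-bind (out-≈ q α) λ eα → ¬¬-bind (out-≈ q β) λ eβ k →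
        k (NormalForm-unique q (NormalForm-out q α) (NormalForm-out q β) (≈-trans eα (≈-trans e (≈-sym eβ)))))

    out-sound : ∀ q α β → out T q α ≡ out T q β → ¬ ¬ (α ++ rep q ≈ β ++ rep q)
    out-sound q α β eq = ¬¬-bind (out-≈ q α) λ eα → ¬¬-bind (out-≈ q β) λ eβ k →
      k (≈-trans (≈-sym eα) (≈-trans (≈-reflexive (cong (_++ rep q) eq)) eβ))

    TauRun-holds : ∀ {P : Word G → Set} {s t} → TauRun G P s t → s ≡ t ⊎ P t
    TauRun-holds done         = inj₁ refl
    TauRun-holds (more _ p r) = inj₂ (TauRun-end p r)

    -- The second hypothesis excludes a matching run that erases `β` and acts inside `rep q`. It
    -- holds in each consistency condition: in the first `rep q0` is empty, in the others `β` has
    -- nonempty output. The double negation goes because weak steps are decidable.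
    WeakStep-transfer : ∀ q {α β a χ} → ¬ ¬ (α ++ rep q ≈ β ++ rep q) →
      ¬ (β ++ rep q ≈ rep q) ⊎ rep q ≡ [] → WeakStep G T q α a χ → WeakStep G T q β a χ
    WeakStep-transfer q ¬¬e h (inj₁ (τ , eq)) = inj₁ (τ , trans eq (out-complete q ¬¬e))
    WeakStep-transfer q {α} {β} {a} {χ} ¬¬e h (inj₂ (αₖ , α′ , r , st , eq)) =
      decidable-stable (WeakStep? q β a χ)
        (¬¬-bind ¬¬e λ e → ¬¬-bind (out-sound q αₖ α (TauRun-end refl r)) λ eₖ k → k (main (≈-trans eₖ e)))
      where
      γ = rep q
      main : αₖ ++ γ ≈ β ++ γ → WeakStep G T q β a χ
      main e with ≈-match e (Step-++ γ st)
      ... | inj₁ (τ , e′) = inj₁ (τ , trans (sym eq) (out-complete q λ k → k e′))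
      ... | inj₂ (P , f , tₖ , t′ , run , st′ , e′) with run-split β refl run st′
      ...   | inj₁ (βₖ , β′ , run′ , st″ , refl) = inj₂ (βₖ , β′
          , TauRun-map (λ p → sym (out-complete q λ k → k (≈-trans (≈-sym e) (f p)))) run′
          , st″ , trans (sym (out-complete q λ k → k e′)) eq)
      ...   | inj₂ (run′ , run″) = ⊥-elim (h-excludes h)
        where
        h-excludes : ¬ (β ++ γ ≈ γ) ⊎ γ ≡ [] → ⊥
        h-excludes (inj₂ γ≡[]) = []-no-step (subst (λ w → TauRun G P w tₖ) γ≡[] run″) st′
        h-excludes (inj₁ ¬e) with TauRun-holds {P = λ x → P (x ++ γ)} run′
        ... | inj₁ refl = ¬e ≈-refl
        ... | inj₂ p    = ¬e (≈-trans (≈-sym e) (f p))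

    Approx-≈ : ∀ q α β → ¬ ¬ (α ++ rep q ≈ β ++ rep q) →
               ¬ (β ++ rep q ≈ rep q) ⊎ rep q ≡ [] → Approx G T q α β
    Approx-≈ q α β ¬¬e h a χ = WeakStep-transfer q ¬¬e h , WeakStep-transfer q
      (λ k → ¬¬e λ e → k (≈-sym e))
      (case h of λ { (inj₁ ¬r) → inj₁ (λ r → ¬¬e λ e → ¬r (≈-trans (≈-sym e) r)) ; (inj₂ eq) → inj₂ eq })

    consistent : Consistent G T
    consistent =
        (λ A e → Approx-≈ q0 [ A ] [] (out-sound q0 [ A ] [] e) (inj₂ rep-q0))
      , (λ q A ne → Approx-≈ q [ A ] (out T q [ A ])
           (out-sound q _ _ (sym (cong proj₂ (run-out q [ A ]))))
           (inj₁ λ r → ne (trans (sym (cong proj₂ (run-out q [ A ]))) (out-complete q {out T q [ A ]} {[]} λ k → k r))))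
      , (λ q A C e e′ → Approx-≈ q (A ∷ C ∷ []) [ C ] (out-sound q _ _ (trans e (sym e′)))
           (inj₁ λ r → contradiction (trans (sym e′) (out-complete q {[ C ]} {[]} λ k → k r)) λ ()))

    apply-sound : ∀ α β → apply T α ≡ apply T β → α ≈ β
    apply-sound = Soundness.sound G T nfc consistent

    ++rep-q0 : ∀ α → α ++ rep q0 ≡ α
    ++rep-q0 α = trans (cong (α ++_) rep-q0) (List.++-identityʳ α)

    apply-complete : ∀ α β → α ≈ β → apply T α ≡ apply T β
    apply-complete α β e = out-complete q0 {α} {β} λ k →
      k (subst₂ _≈_ (sym (++rep-q0 α)) (sym (++rep-q0 β)) e)

    ≈-dec : ∀ α β → Dec (α ≈ β)
    ≈-dec α β = map′ (apply-sound α β) (apply-complete α β) (List.≡-dec Fin._≟_ _ _)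

    ≈-stable : ∀ {α β} → ¬ ¬ (α ≈ β) → α ≈ β
    ≈-stable {α} {β} = decidable-stable (≈-dec α β)

    rep-≎ : ∀ γ → rep (state q0 γ) ≎ γ
    rep-≎ γ = subst (rep (state q0 γ) ≎_) (++rep-q0 γ) (rep-state q0 γ)

    Cand-≎ : ∀ {A γ δ α} → γ ≎ δ → Cand G _<V_ A γ α → Cand G _<V_ A δ α
    Cand-≎ {A} {α = α} (le , ge) cand =
      mkCand (≈-stable (replace-suffix le {α} {[ A ]} (proj₁ cand))) (RF-⊑ ge (Cand-RF cand))

    CanonOut-≎ : ∀ {A γ δ α} → γ ≎ δ → CanonOut G _<V_ A γ α → CanonOut G _<V_ A δ α
    CanonOut-≎ eq (cand , longest , least) = Cand-≎ eq cand
      , (λ α′ c → longest α′ (Cand-≎ (≎-sym eq) c)) , (λ α′ c → least α′ (Cand-≎ (≎-sym eq) c))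

    ≎⇒SameR : ∀ {γ δ} → γ ≎ δ → SameR G γ δ
    ≎⇒SameR (le , ge) X = (λ r → ≈-stable (le X r)) , (λ r → ≈-stable (ge X r))

    SameR⇒≎ : ∀ {γ δ} → SameR G γ δ → γ ≎ δ
    SameR⇒≎ s = (λ X r k → k (proj₁ (s X) r)) , (λ X r k → k (proj₂ (s X) r))

    isCanonical : IsCanonical G _<V_ T
    isCanonical = state q0 , refl
      , (λ q → rep q , distinct _ _ (rep-≎ (rep q)))
      , (λ γ γ′ → (λ eq → ≎⇒SameR (≎-trans (≎-sym (rep-≎ γ)) (subst (λ q → rep q ≎ γ′) (sym eq) (rep-≎ γ′))))
                , (λ s → distinct _ _ (≎-trans (rep-≎ γ) (≎-trans (SameR⇒≎ s) (≎-sym (rep-≎ γ′))))))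
      , (λ γ A → refl , CanonOut-≎ (rep-≎ γ) (output (state q0 γ) A))

-- Constructing the canonical transducer

words : ∀ n → ℕ → List (List (Fin n))
words n zero    = [ [] ]
words n (suc b) = [] ∷ cartesianProductWith _∷_ (allFin n) (words n b)

∈-words : ∀ {n b} (α : List (Fin n)) → length α ≤ b → α ∈ words n b
∈-words {b = zero}  []      _        = here refl
∈-words {b = suc b} []      _        = here refl
∈-words {b = suc b} (X ∷ α) (s≤s le) = there (∈-cartesianProductWith⁺ _∷_ (∈-allFin X) (∈-words α le))

-- The canonical transducer needs only finitely many decisions about ≈; in continuation passing style the
-- construction serves both for a decidable ≈ and, with Ans = ⊥, under a double negation.
module Construction {n m : ℕ} (G : BPA n m) (normed : Normed G)
  (_<V_ : Rel (Fin n) 0ℓ) (sto : IsStrictTotalOrder _≡_ _<V_)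
  {r : Level} {Ans : Set r} (decide : ∀ α β → Cont Ans (Dec (_∼_ G α β))) where
  open Bisimilarity G
  open Norms G normed
  open NormBound G normed using (normBound; short-norm)
  open Lexicographic G _<V_ sto
  open Canonicity G normed _<V_ sto

  RF? : ∀ α γ → Cont Ans (Dec (RF α γ))
  RF? []      γ k = k (yes [])
  RF? (X ∷ α) γ k = decide (X ∷ α ++ γ) (α ++ γ) λ red? → RF? α γ λ rf? →
    k (map′ (λ (¬e , rf) → ¬e ∷ rf) (λ { (¬e ∷ rf) → ¬e , rf }) (¬? red? ×-dec rf?))

  Cand? : ∀ A γ α → Cont Ans (Dec (Cand G _<V_ A γ α))
  Cand? A γ α k = decide (α ++ γ) (A ∷ γ) λ e? → RF? α γ λ rf? →
    k (e? ×-dec map′ RF⇒RedundancyFree RedundancyFree⇒RF rf?)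

  Cand-bound : ∀ {A γ α} → Cand G _<V_ A γ α → length α ≤ normBound
  Cand-bound {A} c = let (l , l≤ , p) = short-norm A in ℕ.≤-trans (Cand-length p (proj₁ c) (Cand-RF c)) l≤

  canonOut : ∀ A γ → Cont Ans (Σ (Word G) (CanonOut G _<V_ A γ))
  canonOut A γ k = decide (A ∷ γ) γ λ red? → Cont-All (Cand? A γ) (words n normBound) λ cand? →
    k (select red? (least cand?))
    where
    ∈-cands : ∀ {α} → Cand G _<V_ A γ α → α ∈ words n normBound
    ∈-cands c = ∈-words _ (Cand-bound c)
    select : Dec (A ∷ γ ≈ γ) →
             (Σ (Word G) λ α → Cand G _<V_ A γ α ×
                (∀ {β} → β ∈ words n normBound → Cand G _<V_ A γ β → α ≼ β))
           ⊎ (∀ {β} → β ∈ words n normBound → ¬ Cand G _<V_ A γ β) →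
             Σ (Word G) (CanonOut G _<V_ A γ)
    -- A candidate always exists: the empty word if `A` is redundant before `γ`, and `[ A ]`
    -- otherwise.
    select (yes e) (inj₂ none) = let c = mkCand (≈-sym e) [] in ⊥-elim (none (∈-cands c) c)
    select (no ¬e) (inj₂ none) = let c = mkCand ≈-refl (¬e ∷ []) in ⊥-elim (none (∈-cands c) c)
    select _ (inj₁ (α , c , min)) = α , c , longest , first
      where
      longest : ∀ β → Cand G _<V_ A γ β → length β ≤ length α
      longest β cβ with min (∈-cands cβ) cβ
      ... | inj₁ lt       = ℕ.<⇒≤ lt
      ... | inj₂ (eq , _) = ℕ.≤-reflexive (sym eq)
      first : ∀ β → Cand G _<V_ A γ β → length β ≡ length α → α ≡ β ⊎ LexLt G _<V_ α β
      first β cβ eq with min (∈-cands cβ) cβ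
      ... | inj₁ lt            = ⊥-elim (ℕ.<⇒≢ lt eq)
      ... | inj₂ (_ , inj₁ e)  = inj₁ e
      ... | inj₂ (_ , inj₂ lt) = inj₂ (≺⇒LexLt lt)

  Profile : Word G → Set₁
  Profile γ = ∀ X → Dec (R G γ X)

  profile : ∀ γ → Cont Ans (Profile γ)
  profile γ = Cont-Fin λ X → decide (X ∷ γ) γ

  ≎? : ∀ {γ δ} → Profile γ → Profile δ → Dec (γ ≎ δ)
  ≎? f g = (Fin.all? λ X → f X →-dec ¬? (¬? (g X))) ×-dec (Fin.all? λ X → g X →-dec ¬? (¬? (f X)))

  bit : ∀ {a} {A : Set a} → Dec A → Fin 2
  bit (yes _) = zero
  bit (no _)  = suc zero

  bit-≡ : ∀ {a b} {A : Set a} {B : Set b} (d : Dec A) (d′ : Dec B) → bit d ≡ bit d′ → A → B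
  bit-≡ (yes a) (yes b) _  _ = b
  bit-≡ (yes a) (no ¬b) () _
  bit-≡ (no ¬a) _       _  a = ⊥-elim (¬a a)

  -- A profile is coded by `n` bits; this is the origin of the bound `2 ^ n` on the number of
  -- states.
  code : ∀ {γ} → Profile γ → Fin (2 ^ n)
  code f = funToFin (λ X → bit (f X))

  code-≡ : ∀ {γ δ} (f : Profile γ) (g : Profile δ) → code f ≡ code g → γ ≎ δ
  code-≡ f g eq = (λ X r k → k (bit-≡ (f X) (g X) (bits X) r))
                , (λ X r k → k (bit-≡ (g X) (f X) (sym (bits X)) r))
    where
    bits : ∀ X → bit (f X) ≡ bit (g X)
    bits X = trans (sym (Fin.finToFun-funToFin (λ X → bit (f X)) X))
      (trans (cong (λ c → finToFun c X) eq) (Fin.finToFun-funToFin (λ X → bit (g X)) X))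

  record Reps : Set₁ where
    field
      size     : ℕ
      rep      : Fin size → Word G
      start    : Fin size
      rep-[]   : rep start ≡ []
      distinct : ∀ i j → rep i ≎ rep j → i ≡ j

  reps-bound : (S : Reps) → (∀ i → Profile (Reps.rep S i)) → Reps.size S ≤ 2 ^ n
  reps-bound S f = ℕ.≮⇒≥ λ lt → let (i , j , i<j , eq) = Fin.pigeonhole lt (λ i → code (f i)) in
    ℕ.<⇒≢ i<j (cong toℕ (Reps.distinct S i j (code-≡ (f i) (f j) eq)))

  ClosedReps : Reps → Set₁
  ClosedReps S = ∀ i A → Σ (Fin size) λ j → rep j ≎ A ∷ rep i
    where open Reps S

  Missing : Reps → Set₁
  Missing S = Σ (Fin size) λ i → Σ (Fin n) λ A → ∀ j → ¬ (rep j ≎ A ∷ rep i)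
    where open Reps S

  extend : (S : Reps) → Missing S → Reps
  extend S (i , A , new) = record
    { size     = suc (Reps.size S)
    ; rep      = λ { zero → A ∷ Reps.rep S i ; (suc j) → Reps.rep S j }
    ; start    = suc (Reps.start S)
    ; rep-[]   = Reps.rep-[] S
    ; distinct = λ
      { zero    zero    _ → refl
      ; zero    (suc j) e → ⊥-elim (new j (≎-sym e))
      ; (suc j) zero    e → ⊥-elim (new j e)
      ; (suc j) (suc l) e → cong suc (Reps.distinct S j l e) } }

  closed⊎missing : (S : Reps) → (∀ i → Profile (Reps.rep S i)) → (∀ i A → Profile (A ∷ Reps.rep S i)) →
                   ClosedReps S ⊎ Missing S
  closed⊎missing S f g with Fin.any? (λ i → Fin.any? λ A → Fin.all? λ j → ¬? (≎? (f j) (g i A)))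
  ... | yes missing = inj₂ missing
  ... | no ¬missing = inj₁ λ i A → found i A (Fin.any? λ j → ≎? (f j) (g i A))
    where
    open Reps S
    found : ∀ i A → Dec (Σ (Fin size) λ j → rep j ≎ A ∷ rep i) → Σ (Fin size) λ j → rep j ≎ A ∷ rep i
    found i A (yes w) = w
    found i A (no ¬w) = ⊥-elim (¬missing (i , A , λ j e → ¬w (j , e)))

  -- Every unsuccessful round adds a representative, and pairwise inequivalent representatives
  -- number at most `2 ^ n`, so the fuel cannot run out before closure.
  close : ∀ fuel (S : Reps) → 2 ^ n < Reps.size S + fuel →
          Cont Ans (Σ Reps λ S → Reps.size S ≤ 2 ^ n × ClosedReps S)
  close fuel S lt k = Cont-Fin (λ i → profile (Reps.rep S i)) λ f →
    Cont-Fin (λ i → Cont-Fin λ A → profile (A ∷ Reps.rep S i)) λ g →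
    next-round fuel lt (reps-bound S f) (closed⊎missing S f g)
    where
    next-round : ∀ fuel → 2 ^ n < Reps.size S + fuel → Reps.size S ≤ 2 ^ n → ClosedReps S ⊎ Missing S → Ans
    next-round fuel       lt le (inj₁ cl) = k (S , le , cl)
    next-round zero       lt le (inj₂ _)  =
      ⊥-elim (ℕ.<⇒≱ lt (subst (_≤ 2 ^ n) (sym (ℕ.+-identityʳ _)) le))
    next-round (suc fuel) lt le (inj₂ ms) =
      close fuel (extend S ms) (subst (2 ^ n <_) (ℕ.+-suc (Reps.size S) fuel) lt) k

  initial : Reps
  initial = record
    { size = 1 ; rep = λ _ → [] ; start = zero ; rep-[] = refl ; distinct = λ { zero zero _ → refl } }

  canonical : Cont Ans Canonical
  canonical k = close (2 ^ n) initial ℕ.≤-refl λ (S , bound , closed) →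
    Cont-Fin (λ q → Cont-Fin λ A → canonOut A (Reps.rep S q)) λ outs →
    k (record
      { T        = record
        { Q  = Reps.size S
        ; Δ  = λ q A → proj₁ (closed q A) , proj₁ (outs q A)
        ; q0 = Reps.start S }
      ; rep      = Reps.rep S
      ; rep-q0   = Reps.rep-[] S
      ; target   = λ q A → proj₂ (closed q A)
      ; output   = λ q A → proj₂ (outs q A)
      ; distinct = Reps.distinct S
      ; Q-bound  = bound })

-- Enumerating bounded transducers and deciding bisimilarity

vecs : ∀ {A : Set} → List A → ∀ k → List (Vec A k)
vecs xs zero    = [ [] ]
vecs xs (suc k) = cartesianProductWith _∷_ xs (vecs xs k)

∈-vecs : ∀ {A : Set} {xs : List A} {k} (f : Fin k → A) → (∀ i → f i ∈ xs) → tabulate f ∈ vecs xs k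
∈-vecs {k = zero}  f f∈ = here refl
∈-vecs {k = suc k} f f∈ = ∈-cartesianProductWith⁺ _∷_ (f∈ zero) (∈-vecs (f ∘ suc) (f∈ ∘ suc))

module Search (n b : ℕ) where

  Table : ℕ → Set
  Table Q = Vec (Vec (Fin Q × List (Fin n)) n) Q

  fromTable : ∀ {Q} → Fin Q → Table Q → Transducer n
  fromTable q0 t = record { Δ = λ q A → lookup (lookup t q) A ; q0 = q0 }

  tables : ∀ Q → List (Table Q)
  tables Q = vecs (vecs (cartesianProductWith _,_ (allFin Q) (words n b)) n) Q

  transducers : ℕ → List (Transducer n)
  transducers zero    = cartesianProductWith fromTable (allFin 0) (tables 0)
  transducers (suc Q) = cartesianProductWith fromTable (allFin (suc Q)) (tables (suc Q)) ++ transducers Q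

  table : (T : Transducer n) → Table (Transducer.Q T)
  table T = tabulate λ q → tabulate λ A → Transducer.Δ T q A

  -- `Δ` is a function and agrees only pointwise with an enumerated one, so the search meets this
  -- tabulated copy instead.
  tabled : Transducer n → Transducer n
  tabled T = fromTable (Transducer.q0 T) (table T)

  tabled-Δ : ∀ T q A → Transducer.Δ (tabled T) q A ≡ Transducer.Δ T q A
  tabled-Δ T q A = trans (cong (λ row → lookup row A) (Vec.lookup∘tabulate _ q)) (Vec.lookup∘tabulate _ A)

  ∈-transducers : ∀ N T → Transducer.Q T ≤ N →
    (∀ q A → length (proj₂ (Transducer.Δ T q A)) ≤ b) → tabled T ∈ transducers N
  ∈-transducers N T Q≤N short = go N Q≤N
    where
    open Transducer T
    exact : tabled T ∈ cartesianProductWith fromTable (allFin Q) (tables Q)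
    exact = ∈-cartesianProductWith⁺ fromTable (∈-allFin q0) (∈-vecs _ λ q → ∈-vecs _ λ A →
      ∈-cartesianProductWith⁺ _,_ (∈-allFin (proj₁ (Δ q A))) (∈-words (proj₂ (Δ q A)) (short q A)))
    go : ∀ N → Q ≤ N → tabled T ∈ transducers N
    go zero    le = subst (λ k → tabled T ∈ cartesianProductWith fromTable (allFin k) (tables k)) (ℕ.n≤0⇒n≡0 le) exact
    go (suc N) le with ℕ.m≤n⇒m<n∨m≡n le
    ... | inj₁ (s≤s lt) = ∈-++⁺ʳ _ (go N lt)
    ... | inj₂ eq       = ∈-++⁺ˡ
      (subst (λ k → tabled T ∈ cartesianProductWith fromTable (allFin k) (tables k)) eq exact)

module Decision {n m : ℕ} (G : BPA n m) (normed : Normed G)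
  (_<V_ : Rel (Fin n) 0ℓ) (sto : IsStrictTotalOrder _≡_ _<V_) where
  open Bisimilarity G
  open Norms G normed using (Cand-length)
  open NormBound G normed using (normBound; short-norm)
  open Canonicity G normed _<V_ sto
  open Search n normBound

  Certificate : Word G → Word G → Transducer n → Set
  Certificate α β T = (IsNFC T × Consistent G T) × apply T α ≡ apply T β

  Certificate? : ∀ α β T → Dec (Certificate α β T)
  Certificate? α β T = valid? (Runs.IsNFC? T) ×-dec List.≡-dec Fin._≟_ _ _
    where
    -- The nfc property is tested first because the decision of consistency takes it as an argument.
    valid? : Dec (IsNFC T) → Dec (IsNFC T × Consistent G T)
    valid? (no ¬nfc) = no λ (nfc , _) → ¬nfc nfc
    valid? (yes nfc) = map′ (nfc ,_) proj₂ (WeakSteps.Consistent? G T nfc)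

  emit-bound : (C : Canonical) → let open Canonical C in ∀ q A → length (proj₂ (Δ q A)) ≤ normBound
  emit-bound C q A =
    let (cand , _)   = Canonical.output C q A
        (l , l≤ , p) = short-norm A
    in ℕ.≤-trans (Cand-length p (proj₁ cand) (Cand-RF cand)) l≤

  tabled-Canonical : Canonical → Canonical
  tabled-Canonical C = record
    { T        = tabled T
    ; rep      = rep
    ; rep-q0   = rep-q0
    ; target   = λ q A → subst (λ d → rep (proj₁ d) ≎ A ∷ rep q) (sym (tabled-Δ T q A)) (target q A)
    ; output   = λ q A → subst (λ d → CanonOut G _<V_ A (rep q) (proj₂ d)) (sym (tabled-Δ T q A)) (output q A)
    ; distinct = distinct
    ; Q-bound  = Q-bound }
    where open Canonical C

  -- Bisimilar words are identified by the canonical transducer, which exists up to double negation;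
  -- all other certificates are sound, so a bounded search is conclusive.
  ≈? : ∀ α β → Dec (α ≈ β)
  ≈? α β with any? (Certificate? α β) (transducers (2 ^ n))
  ... | yes w = let (T , _ , (nfc , con) , eq) = find w in yes (Soundness.sound G T nfc con α β eq)
  ... | no ¬w = no λ e → Construction.canonical G normed _<V_ sto (λ γ δ → ¬¬-dec (γ ≈ δ)) λ C →
    let C′ = tabled-Canonical C
        open Properties C′
    in ¬w (lose (∈-transducers (2 ^ n) (Canonical.T C) (Canonical.Q-bound C) (emit-bound C))
                ((nfc , consistent) , apply-complete α β e))

  canonical : Canonical
  canonical = Construction.canonical G normed _<V_ sto (λ α β k → k (≈? α β)) id

-- The size estimate

sum-map-≤ : ∀ {A : Set} (f : A → ℕ) {b} → (∀ x → f x ≤ b) → ∀ xs → sum (map f xs) ≤ length xs * b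
sum-map-≤ f f≤ []       = z≤n
sum-map-≤ f f≤ (x ∷ xs) = ℕ.+-mono-≤ (f≤ x) (sum-map-≤ f f≤ xs)

sum-allFin-≤ : ∀ {k} (f : Fin k → ℕ) {b} → (∀ x → f x ≤ b) → sum (map f (allFin k)) ≤ k * b
sum-allFin-≤ {k} f {b} f≤ =
  subst (λ l → sum (map f (allFin k)) ≤ l * b) (List.length-tabulate {n = k} id) (sum-map-≤ f f≤ (allFin k))

n≤2^n : ∀ n → n ≤ 2 ^ n
n≤2^n zero    = z≤n
n≤2^n (suc n) = ℕ.+-mono-≤ (ℕ.m^n>0 2 n) (ℕ.≤-trans (n≤2^n n) (ℕ.m≤m+n (2 ^ n) 0))

-- The left side collects the exponents of the number of states (`h`), the alphabet (`h`), the
-- output length (`h * h`) and a factor 4. Both `2` and `h + h` are at most `h * h`, and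
-- `3 ≤ h * h`; hence the power 4 in the theorem.
exponent-≤ : ∀ h → 2 ≤ h → 2 + (h + (h + h * h)) ≤ h ^ 4
exponent-≤ h 2≤h = begin
  2 + (h + (h + h * h)) ≡⟨ cong (2 +_) (sym (ℕ.+-assoc h h (h * h))) ⟩
  2 + ((h + h) + s)     ≤⟨ ℕ.+-mono-≤ 2≤s (ℕ.+-monoˡ-≤ s 2h≤s) ⟩
  s + (s + s)           ≡⟨ cong (λ x → s + (s + x)) (ℕ.+-identityʳ s) ⟨
  3 * s                 ≤⟨ ℕ.*-monoˡ-≤ s (ℕ.≤-trans (ℕ.n≤1+n 3) (ℕ.*-mono-≤ 2≤h 2≤h)) ⟩
  s * s                 ≡⟨ s*s≡h^4 h ⟩
  h ^ 4                 ∎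
  where
  open ℕ.≤-Reasoning
  s = h * h
  2≤s : 2 ≤ s
  2≤s = ℕ.≤-trans (s≤s (s≤s z≤n)) (ℕ.*-mono-≤ 2≤h 2≤h)
  2h≤s : h + h ≤ s
  2h≤s = ℕ.≤-trans (ℕ.≤-reflexive (cong (h +_) (sym (ℕ.+-identityʳ h)))) (ℕ.*-monoˡ-≤ h 2≤h)
  s*s≡h^4 : ∀ h → (h * h) * (h * h) ≡ h * (h * (h * (h * 1)))
  s*s≡h^4 = solve-∀

size-≤ : ∀ {q n g} → n ≤ g → q ≤ 2 ^ n → q + n + q * (n * suc g ^ n) ≤ 2 ^ ((2 + g) ^ 4)
size-≤ {q} {n} {g} n≤g q≤ = begin
  q + n + q * (n * suc g ^ n)        ≤⟨ ℕ.+-mono-≤ (ℕ.+-mono-≤ (ℕ.≤-trans q≤h ^≤x) (ℕ.≤-trans n≤h ^≤x)) prod ⟩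
  -- A fourth copy rounds the sum up to `2 ^ 2` times `x`, whence the summand `2` in the exponent.
  x + x + x                          ≤⟨ ℕ.m≤m+n (x + x + x) x ⟩
  x + x + x + x                      ≡⟨ four x ⟩
  2 ^ (2 + (h + (h + h * h)))        ≤⟨ ℕ.^-monoʳ-≤ 2 (exponent-≤ h (s≤s (s≤s z≤n))) ⟩
  2 ^ (h ^ 4)                        ∎
  where
  open ℕ.≤-Reasoning
  h = 2 + g
  x = 2 ^ (h + (h + h * h))
  n≤h′ : n ≤ h
  n≤h′ = ℕ.≤-trans n≤g (ℕ.m≤n+m g 2)
  q≤h : q ≤ 2 ^ h
  q≤h = ℕ.≤-trans q≤ (ℕ.^-monoʳ-≤ 2 n≤h′)
  n≤h : n ≤ 2 ^ h
  n≤h = ℕ.≤-trans n≤h′ (n≤2^n h)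
  ^≤x : 2 ^ h ≤ x
  ^≤x = ℕ.^-monoʳ-≤ 2 (ℕ.m≤m+n h (h + h * h))
  power : suc g ^ n ≤ 2 ^ (h * h)
  power = begin
    suc g ^ n     ≤⟨ ℕ.^-monoˡ-≤ n (ℕ.≤-trans (ℕ.n≤1+n (suc g)) (n≤2^n h)) ⟩
    (2 ^ h) ^ n   ≡⟨ ℕ.^-*-assoc 2 h n ⟩
    2 ^ (h * n)   ≤⟨ ℕ.^-monoʳ-≤ 2 (ℕ.*-monoʳ-≤ h n≤h′) ⟩
    2 ^ (h * h)   ∎
  prod : q * (n * suc g ^ n) ≤ x
  prod = begin
    q * (n * suc g ^ n)             ≤⟨ ℕ.*-mono-≤ q≤h (ℕ.*-mono-≤ n≤h power) ⟩
    2 ^ h * (2 ^ h * 2 ^ (h * h))   ≡⟨ cong (2 ^ h *_) (ℕ.^-distribˡ-+-* 2 h (h * h)) ⟨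
    2 ^ h * 2 ^ (h + h * h)         ≡⟨ ℕ.^-distribˡ-+-* 2 h (h + h * h) ⟨
    x                               ∎
  four : ∀ x → x + x + x + x ≡ 2 * (2 * x)
  four = solve-∀

theorem4p6 : Σ ℕ λ c →
    ∀ {n m : ℕ} (G : BPA n m) (_<V_ : Rel (Fin n) 0ℓ) →
    IsStrictTotalOrder _≡_ _<V_ →
    Normed G →
    Σ (Transducer n) λ T →
    IsCanonical G _<V_ T
    × (IsNFC T × Consistent G T)
    × (∀ α β → (apply T α ≡ apply T β → _∼_ G α β) × (_∼_ G α β → apply T α ≡ apply T β))
    × sizeT T ≤ 2 ^ ((2 + sizeBPA G) ^ c)
theorem4p6 = 4 , λ {n} {m} G _<V_ sto normed →
  let open Decision G normed _<V_ sto
      module C = Canonicity.Canonical canonical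
      open Canonicity.Properties G normed _<V_ sto canonical
      lengths = sum-allFin-≤ {C.Q} _ λ q → sum-allFin-≤ {n} _ (emit-bound canonical q)
      n≤size  = ℕ.≤-trans (ℕ.m≤m+n n m) (ℕ.m≤m+n (n + m) _)
  in C.T , isCanonical , (nfc , consistent) , (λ α β → apply-sound α β , apply-complete α β)
     , ℕ.≤-trans (ℕ.+-monoʳ-≤ (C.Q + n) lengths) (size-≤ n≤size C.Q-bound)
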